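{- Let $1\le r\le n$, let $p=(p_1,\dots,p_n)$ be a size vector, let $A,B\subseteq S_p$ form a maximal pair of $r$-cross-intersecting families, and let $T$ be the set of coordinates that are relevant for $A$ or for $B$. Then $$|A|\le \frac{|S_p|}{\prod_{i\in T}(p_i-1)^{1-2/p_i}}\quad\text{and}\quad |B|\le \frac{|S_p|}{\prod_{i\in T}(p_i-1)^{1-2/p_i}}.$$
   Context: $[m]=\{1,\dots,m\}$. A size vector is a sequence of integers $p=(p_1,\dots,p_n)$ with $p_i\ge 2$ for all $i$; $S_p=[p_1]\times\cdots\times[p_n]$. Two vectors $x,y\in S_p$ are $r$-intersecting if $|\{i: x_i=y_i\}|\ge r$; families $A,B\subseteq S_p$ are $r$-cross-intersecting if every $x\in A$, $y\in B$ are $r$-intersecting. A pair $(A,B)$ of $r$-cross-intersecting families in $S_p$ is maximal if it maximizes $|A|\cdot|B|$ among all $r$-cross-intersecting pairs in $S_p$. A coordinate $i$ is irrelevant for $A\subseteq S_p$ if whenever two elements of $S_p$ differ only in coordinate $i$ and one lies in $A$, so does the other; otherwise $i$ is relevant for $A$. -}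

module Defs where

open import Algebra.Definitions.RawMonoid using () renaming (_×_ to mult)
open import Algebra.Definitions.RawSemiring using () renaming (_^_ to power)
open import Data.Bool.Base using (Bool; T)
open import Data.Empty using (⊥; ⊥-elim)
open import Data.Fin.Base using (Fin; zero; suc)
import Data.Fin.Properties as Fin
open import Data.Fin.Subset using (Subset; inside; outside) renaming (∣_∣ to size)
open import Data.Integer.Base as ℤ using (+_; -[1+_])
import Data.Integer.Properties as ℤ
open import Data.List.Base as List using (List; []; _∷_; length; filterᵇ; allFin; cartesianProductWith)
open import Data.Nat.Base as ℕ using (ℕ; zero; suc; NonZero; z≤n; s≤s)
import Data.Nat.Properties as ℕ
open import Data.Product.Base using (∃; ∃₂; _×_; _,_; proj₁; proj₂)
open import Data.Rational.Base as ℚ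
  using (ℚ; mkℚ; toℚᵘ; 0ℚ; 1ℚ; _+_; _*_; _-_; -_; 1/_; _≤_; _<_; _/_; positive; nonNegative)
open import Data.Rational.Properties
open import Data.Rational.Unnormalised.Base as ℚᵘ using (mkℚᵘ)
import Data.Rational.Unnormalised.Properties as ℚᵘ
open import Data.Sum.Base using (_⊎_; inj₁; inj₂)
open import Data.Vec.Base using (Vec; []; _∷_; lookup; tabulate)
open import Data.Vec.Relation.Unary.All using (All; []; _∷_)
open import Data.Vec.Relation.Unary.All.Properties using (lookup⁺)
open import Relation.Binary.Definitions using (tri<; tri≈; tri>)
open import Relation.Binary.PropositionalEquality
  using (_≡_; _≢_; refl; sym; trans; cong; cong₂; subst; subst₂)
open import Relation.Nullary using (¬_; yes; no; does)

infixr 8 _^ℚ_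

_^ℚ_ : ℚ → ℕ → ℚ
_^ℚ_ = power ℚ.+-*-rawSemiring

private
  _·_ : ℕ → ℚ → ℚ
  _·_ = mult ℚ.+-0-rawMonoid

  abstract
    dense : ∀ {a b} → a < b → ∃ λ m → a < m × m < b
    dense = <-dense

    *-pos : ∀ {a b} → 0ℚ < a → 0ℚ < b → 0ℚ < a * b
    *-pos {a} {b} 0<a 0<b =
      subst (_< a * b) (*-zeroʳ a) (*-monoʳ-<-pos a {{positive 0<a}} 0<b)

    *-mono-<-≤ : ∀ {a b c d} → 0ℚ ≤ a → a < c → 0ℚ < b → b ≤ d → a * b < c * d
    *-mono-<-≤ {a} {b} {c} {d} 0≤a a<c 0<b b≤d = <-≤-trans
      (*-monoˡ-<-pos b {{positive 0<b}} a<c)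
      (*-monoˡ-≤-nonNeg c {{nonNegative (<⇒≤ (≤-<-trans 0≤a a<c))}} b≤d)

    *-mono-≤ : ∀ {a b c d} → 0ℚ ≤ a → 0ℚ ≤ d → a ≤ c → b ≤ d → a * b ≤ c * d
    *-mono-≤ {a} {b} {c} {d} 0≤a 0≤d a≤c b≤d = ≤-trans
      (*-monoˡ-≤-nonNeg a {{nonNegative 0≤a}} b≤d)
      (*-monoʳ-≤-nonNeg d {{nonNegative 0≤d}} a≤c)

    *-mono-< : ∀ {a b c d} → 0ℚ ≤ a → a < c → 0ℚ < b → b < d → a * b < c * d
    *-mono-< 0≤a a<c 0<b b<d = *-mono-<-≤ 0≤a a<c 0<b (<⇒≤ b<d)

    0<1 : 0ℚ < 1ℚ
    0<1 = positive⁻¹ 1ℚ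

    a<a+d : ∀ a {d} → 0ℚ < d → a < a + d
    a<a+d a {d} 0<d = subst (_< a + d) (+-identityʳ a) (+-monoʳ-< a 0<d)

    interchange : ∀ a b c d → (a * b) * (c * d) ≡ (a * c) * (b * d)
    interchange a b c d = solve 4 (λ a b c d →
        ((a :* b) :* (c :* d)) := ((a :* c) :* (b :* d))) refl a b c d
      where open import Data.Rational.Solver
            open +-*-Solver

    recip : ∀ a → 0ℚ < a → ∃ λ b → 0ℚ < b × b * a ≡ 1ℚ
    recip a 0<a = let instance
                        _ = positive 0<a
                        _ = pos⇒nonZero a
                  in 1/ a , positive⁻¹ (1/ a) {{1/pos⇒pos a}} , *-inverseˡ a

    ^-pos : ∀ {t} k → 0ℚ < t → 0ℚ < t ^ℚ k
    ^-pos zero    _   = 0<1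
    ^-pos (suc k) 0<t = *-pos 0<t (^-pos k 0<t)

    ^-mono-≤ : ∀ {s t} k → 0ℚ < s → s ≤ t → s ^ℚ k ≤ t ^ℚ k
    ^-mono-≤ zero    0<s s≤t = ≤-refl
    ^-mono-≤ (suc k) 0<s s≤t =
      *-mono-≤ (<⇒≤ 0<s) (<⇒≤ (^-pos k (<-≤-trans 0<s s≤t))) s≤t (^-mono-≤ k 0<s s≤t)

    ^-mono-< : ∀ {s t} k .{{_ : NonZero k}} → 0ℚ < s → s < t → s ^ℚ k < t ^ℚ k
    ^-mono-< (suc k) 0<s s<t =
      *-mono-<-≤ (<⇒≤ 0<s) s<t (^-pos k 0<s) (^-mono-≤ k 0<s (<⇒≤ s<t))

    1^ : ∀ k → 1ℚ ^ℚ k ≡ 1ℚ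
    1^ zero    = refl
    1^ (suc k) = trans (*-identityˡ (1ℚ ^ℚ k)) (1^ k)

    t≤t^k : ∀ {t} k .{{_ : NonZero k}} → 1ℚ ≤ t → t ≤ t ^ℚ k
    t≤t^k {t} (suc k) 1≤t = subst (_≤ t * t ^ℚ k) (*-identityʳ t)
      (*-mono-≤ (<⇒≤ 0<t) (<⇒≤ (^-pos k 0<t)) ≤-refl
        (subst (_≤ t ^ℚ k) (1^ k) (^-mono-≤ k 0<1 1≤t)))
      where
      0<t : 0ℚ < t
      0<t = <-≤-trans 0<1 1≤t

    n·1 : ∀ n → toℚᵘ (n · 1ℚ) ℚᵘ.≃ mkℚᵘ (+ n) 0
    n·1 zero    = ℚᵘ.*≡* refl
    n·1 (suc n) = ℚᵘ.≃-trans (toℚᵘ-homo-+ 1ℚ (n · 1ℚ))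
      (ℚᵘ.≃-trans (ℚᵘ.+-congʳ (toℚᵘ 1ℚ) (n·1 n))
        (ℚᵘ.*≡* (cong (ℤ._* (+ 1)) (cong (λ z → (+ 1) ℤ.+ z) (ℤ.*-identityʳ (+ n))))))

    ·-homo : ∀ n d → (n · 1ℚ) * d ≡ n · d
    ·-homo zero    d = *-zeroˡ d
    ·-homo (suc n) d = trans (*-distribʳ-+ d 1ℚ (n · 1ℚ))
      (cong₂ _+_ (*-identityˡ d) (·-homo n d))

    q≤n : ∀ q → ∃ λ n → q ≤ n · 1ℚ
    q≤n q@(mkℚ i d-1 _) = ℤ.∣ i ∣ , toℚᵘ-cancel-≤ (ℚᵘ.≤-respʳ-≃ (ℚᵘ.≃-sym (n·1 ℤ.∣ i ∣))
      (ℚᵘ.*≤* (ℤ.≤-trans (ℤ.≤-reflexive (ℤ.*-identityʳ i)) (bound i))))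
      where
      bound : ∀ i → i ℤ.≤ (+ ℤ.∣ i ∣) ℤ.* (+ suc d-1)
      bound (+ m)    = subst ((+ m) ℤ.≤_) (ℤ.pos-* m (suc d-1)) (ℤ.+≤+ (ℕ.m≤m*n m (suc d-1)))
      bound -[1+ m ] = ℤ.-≤+

    archimedean : ∀ b {d} → 0ℚ < d → ∃ λ n → b ≤ n · d
    archimedean b {d} 0<d with recip d 0<d
    ... | e , 0<e , ed≡1 with q≤n (b * e)
    ... | n , be≤n = n , subst₂ _≤_
            (trans (*-assoc b e d) (trans (cong (b *_) ed≡1) (*-identityʳ b)))
            (·-homo n d)
            (*-monoʳ-≤-nonNeg d {{nonNegative (<⇒≤ 0<d)}} be≤n)

-- Two-sided Dedekind cuts: L s means s < x, and U s means x < s.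
record ℝ : Set₁ where
  field
    L U         : ℚ → Set
    L-inhabited : ∃ L
    U-inhabited : ∃ U
    L-lower     : ∀ {s t} → s < t → L t → L s
    U-upper     : ∀ {s t} → s < t → U s → U t
    L-open      : ∀ {s} → L s → ∃ λ t → s < t × L t
    U-open      : ∀ {t} → U t → ∃ λ s → s < t × U s
    disjoint    : ∀ {s} → L s → U s → ⊥
    located     : ∀ {s t} → s < t → L s ⊎ U t

  L<U : ∀ {s t} → L s → U t → s < t
  L<U {s} {t} Ls Ut with <-cmp s t
  ... | tri< s<t _ _ = s<t
  ... | tri≈ _ refl _ = ⊥-elim (disjoint Ls Ut)
  ... | tri> _ _ t<s = ⊥-elim (disjoint (L-lower t<s Ls) Ut)

infix 4 _<ᴿ_ _≤ᴿ_

_<ᴿ_ : ℝ → ℝ → Set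
x <ᴿ y = ∃ λ q → ℝ.U x q × ℝ.L y q

_≤ᴿ_ : ℝ → ℝ → Set
x ≤ᴿ y = ¬ (y <ᴿ x)

fromℚ : ℚ → ℝ
fromℚ q = record
  { L           = _< q
  ; U           = q <_
  ; L-inhabited = q - 1ℚ ,
      subst (q - 1ℚ <_) (+-identityʳ q) (+-monoʳ-< q (negative⁻¹ (- 1ℚ)))
  ; U-inhabited = q + 1ℚ , a<a+d q 0<1
  ; L-lower     = <-trans
  ; U-upper     = λ s<t q<s → <-trans q<s s<t
  ; L-open      = λ s<q → dense s<q
  ; U-open      = λ q<t → let m , q<m , m<t = dense q<t in m , m<t , q<m
  ; disjoint    = <-asym
  ; located     = loc
  }
  where
  loc : ∀ {s t} → s < t → s < q ⊎ q < t
  loc {s} s<t with s <? q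
  ... | yes s<q = inj₁ s<q
  ... | no  s≮q = inj₂ (≤-<-trans (≮⇒≥ s≮q) s<t)

fromℕ : ℕ → ℝ
fromℕ n = fromℚ (+ n / 1)

record ℝ⁺ : Set₁ where
  constructor _,⁺_
  field
    value      : ℝ
    isPositive : ℝ.L value 0ℚ
  open ℝ value public

open ℝ⁺ public using (value)

fromℕ⁺ : (n : ℕ) .{{_ : NonZero n}} → ℝ⁺
fromℕ⁺ n = fromℕ n ,⁺ positive⁻¹ (+ n / 1) {{normalize-pos n 1}}

private
  abstract
    -- A positive real has rational bounds of ratio arbitrarily close to 1.
    squeeze : (x : ℝ⁺) → ∀ {u v} → 0ℚ < u → u < v →
              ∃₂ λ a b → 0ℚ < a × ℝ⁺.L x a × ℝ⁺.U x b × b * u ≤ a * v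
    squeeze x {u} {v} 0<u u<v
      with ℝ⁺.L-open x (ℝ⁺.isPositive x) | ℝ⁺.U-inhabited x | recip u 0<u
    ... | a₀ , 0<a₀ , La₀ | b₀ , Ub₀ | w , 0<w , wu≡1 =
        search (proj₁ arch) ≤-refl La₀
          (≤-trans (proj₂ arch) (<⇒≤ (subst (_< a₀ + n · δ′) (+-identityˡ (n · δ′)) (+-monoˡ-< (n · δ′) 0<a₀))))
      where
      open ℝ⁺ x

      gap : 0ℚ < v - u
      gap = subst (_< v - u) (+-inverseʳ u) (+-monoˡ-< (- u) u<v)

      δ : ℚ
      δ = a₀ * ((v - u) * w)

      0<δ : 0ℚ < δ
      0<δ = *-pos 0<a₀ (*-pos gap 0<w)

      δ′ : ℚ
      δ′ = proj₁ (dense 0<δ)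

      0<δ′ : 0ℚ < δ′
      0<δ′ = proj₁ (proj₂ (dense 0<δ))

      δ′<δ : δ′ < δ
      δ′<δ = proj₂ (proj₂ (dense 0<δ))

      arch : ∃ λ n → b₀ ≤ n · δ′
      arch = archimedean b₀ 0<δ′

      n : ℕ
      n = proj₁ arch

      δu : δ * u ≡ a₀ * (v - u)
      δu = trans (*-assoc a₀ _ u) (cong (a₀ *_)
             (trans (*-assoc (v - u) w u) (trans (cong ((v - u) *_) wu≡1) (*-identityʳ (v - u)))))

      step : ∀ {a} → a₀ ≤ a → (a + δ) * u ≤ a * v
      step {a} a₀≤a = subst₂ _≤_ (sym (*-distribʳ-+ u a δ)) eq
        (+-monoʳ-≤ (a * u) (≤-trans (≤-reflexive δu)
          (*-monoʳ-≤-nonNeg (v - u) {{nonNegative (<⇒≤ gap)}} a₀≤a)))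
        where
        eq : a * u + a * (v - u) ≡ a * v
        eq = trans (sym (*-distribˡ-+ a u (v - u))) (cong (a *_)
               (trans (+-comm u (v - u)) (trans (+-assoc v (- u) u)
                 (trans (cong (λ z → v + z) (+-inverseˡ u)) (+-identityʳ v)))))

      search : ∀ m {a} → a₀ ≤ a → L a → b₀ ≤ a + m · δ′ →
               ∃₂ λ a b → 0ℚ < a × L a × U b × b * u ≤ a * v
      search zero {a} a₀≤a La b₀≤a = ⊥-elim (<-irrefl refl
        (<-≤-trans (L<U La Ub₀) (subst (b₀ ≤_) (+-identityʳ a) b₀≤a)))
      search (suc m) {a} a₀≤a La b₀≤ with located (+-monoʳ-< a δ′<δ)
      ... | inj₁ La′ = search m (≤-trans a₀≤a (<⇒≤ (a<a+d a 0<δ′))) La′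
                         (subst (b₀ ≤_) (sym (+-assoc a δ′ (m · δ′))) b₀≤)
      ... | inj₂ Ub  = a , a + δ , <-≤-trans 0<a₀ a₀≤a , La , Ub , step a₀≤a

    U-pos : (x : ℝ⁺) → ∀ {b} → ℝ⁺.U x b → 0ℚ < b
    U-pos x = ℝ⁺.L<U x (ℝ⁺.isPositive x)

infixl 7 _*ᴿ_ _÷ᴿ_
infix  8 _⁻¹

-- Since x and y are positive, s < x y iff s < a b for some rationals
-- 0 < a < x and 0 < b < y, and dually for upper bounds.
_*ᴿ_ : ℝ⁺ → ℝ⁺ → ℝ⁺
x *ᴿ y = record
  { L           = L′
  ; U           = U′
  ; L-inhabited = 0ℚ , L0
  ; U-inhabited = let a , Ua = X.U-inhabited ; b , Ub = Y.U-inhabited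
                  in a * b + 1ℚ , a , b , Ua , Ub , a<a+d (a * b) 0<1
  ; L-lower     = λ s<t (a , b , La , Lb , t<ab) → a , b , La , Lb , <-trans s<t t<ab
  ; U-upper     = λ s<t (a , b , Ua , Ub , ab<s) → a , b , Ua , Ub , <-trans ab<s s<t
  ; L-open      = λ (a , b , La , Lb , s<ab) → let m , s<m , m<ab = dense s<ab
                  in m , s<m , a , b , La , Lb , m<ab
  ; U-open      = λ (a , b , Ua , Ub , ab<t) → let m , ab<m , m<t = dense ab<t
                  in m , m<t , a , b , Ua , Ub , ab<m
  ; disjoint    = λ (a , b , (0<a , La) , (0<b , Lb) , s<ab) (c , d , Uc , Ud , cd<s) →
                  <-asym (<-trans s<ab (*-mono-< (<⇒≤ 0<a) (X.L<U La Uc) 0<b (Y.L<U Lb Ud))) cd<s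
  ; located     = loc
  } ,⁺ L0
  where
  module X = ℝ⁺ x
  module Y = ℝ⁺ y

  L′ U′ : ℚ → Set
  L′ s = ∃₂ λ a b → (0ℚ < a × X.L a) × (0ℚ < b × Y.L b) × s < a * b
  U′ s = ∃₂ λ a b → X.U a × Y.U b × a * b < s

  L0 : L′ 0ℚ
  L0 = let a , 0<a , La = X.L-open X.isPositive
           b , 0<b , Lb = Y.L-open Y.isPositive
       in a , b , (0<a , La) , (0<b , Lb) , *-pos 0<a 0<b

  loc⁺ : ∀ {s t} → 0ℚ < s → s < t → L′ s ⊎ U′ t
  loc⁺ {s} {t} 0<s s<t with dense s<t
  ... | m , s<m , m<t with dense m<t
  ... | t′ , m<t′ , t′<t with squeeze x 0<s s<m | squeeze y (<-trans 0<s s<m) m<t′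
  ... | a , b , 0<a , La , Ub , bs≤am | c , d , 0<c , Lc , Ud , dm≤ct′ with s <? a * c
  ... | yes s<ac = inj₁ (a , c , (0<a , La) , (0<c , Lc) , s<ac)
  ... | no  s≮ac = inj₂ (b , d , Ub , Ud , ≤-<-trans bd≤t′ t′<t)
    where
    0<m = <-trans 0<s s<m
    0<t′ = <-trans 0<m m<t′

    bdsm≤ : (b * d) * (s * m) ≤ t′ * (s * m)
    bdsm≤ = ≤-trans (≤-reflexive (interchange b d s m))
      (≤-trans (*-mono-≤ (<⇒≤ (*-pos (U-pos x Ub) 0<s)) (<⇒≤ (*-pos 0<c 0<t′)) bs≤am dm≤ct′)
      (≤-trans (≤-reflexive (interchange a m c t′))
      (≤-trans (*-monoʳ-≤-nonNeg (m * t′) {{nonNegative (<⇒≤ (*-pos 0<m 0<t′))}} (≮⇒≥ s≮ac))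
      (≤-reflexive (trans (sym (*-assoc s m t′)) (*-comm (s * m) t′))))))

    bd≤t′ : b * d ≤ t′
    bd≤t′ = *-cancelʳ-≤-pos (s * m) {{positive (*-pos 0<s 0<m)}} bdsm≤

  loc : ∀ {s t} → s < t → L′ s ⊎ U′ t
  loc {s} s<t with 0ℚ <? s
  ... | yes 0<s = loc⁺ 0<s s<t
  ... | no  0≮s = let a , b , La , Lb , 0<ab = L0
                  in inj₁ (a , b , La , Lb , ≤-<-trans (≮⇒≥ 0≮s) 0<ab)

_⁻¹ : ℝ⁺ → ℝ⁺
x ⁻¹ = record
  { L           = L′
  ; U           = U′
  ; L-inhabited = 0ℚ , L0
  ; U-inhabited = let a , 0<a , La = X.L-open X.isPositive
                      w , 0<w , wa≡1 = recip a 0<a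
                  in w + 1ℚ , a , 0<a , La ,
                     subst (_< a * (w + 1ℚ)) (trans (*-comm a w) wa≡1)
                       (*-monoʳ-<-pos a {{positive 0<a}} (a<a+d w 0<1))
  ; L-lower     = λ s<t (a , Ua , ta<1) →
                  a , Ua , <-trans (*-monoˡ-<-pos a {{positive (U-pos x Ua)}} s<t) ta<1
  ; U-upper     = λ s<t (a , 0<a , La , 1<as) →
                  a , 0<a , La , <-trans 1<as (*-monoʳ-<-pos a {{positive 0<a}} s<t)
  ; L-open      = λ {s} (a , Ua , sa<1) →
                  let w , 0<w , wa≡1 = recip a (U-pos x Ua)
                      s<w = *-cancelʳ-<-nonNeg a {{nonNegative (<⇒≤ (U-pos x Ua))}} {s} {w}
                              (subst (s * a <_) (sym wa≡1) sa<1)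
                      m , s<m , m<w = dense s<w
                  in m , s<m , a , Ua ,
                     subst (m * a <_) wa≡1 (*-monoˡ-<-pos a {{positive (U-pos x Ua)}} m<w)
  ; U-open      = λ {t} (a , 0<a , La , 1<at) →
                  let w , 0<w , wa≡1 = recip a 0<a
                      aw≡1 = trans (*-comm a w) wa≡1
                      w<t = *-cancelˡ-<-nonNeg a {{nonNegative (<⇒≤ 0<a)}} {w} {t}
                              (subst (_< a * t) (sym aw≡1) 1<at)
                      m , w<m , m<t = dense w<t
                  in m , m<t , a , 0<a , La ,
                     subst (_< a * m) aw≡1 (*-monoʳ-<-pos a {{positive 0<a}} w<m)
  ; disjoint    = dis
  ; located     = loc
  } ,⁺ L0
  where
  module X = ℝ⁺ x

  L′ U′ : ℚ → Set
  L′ s = ∃ λ a → X.U a × s * a < 1ℚ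
  U′ s = ∃ λ a → 0ℚ < a × X.L a × 1ℚ < a * s

  small : ∀ {s a} → s ≤ 0ℚ → X.U a → s * a < 1ℚ
  small {s} {a} s≤0 Ua = ≤-<-trans
    (subst (s * a ≤_) (*-zeroˡ a)
      (*-monoʳ-≤-nonNeg a {{nonNegative (<⇒≤ (U-pos x Ua))}} s≤0)) 0<1

  L0 : L′ 0ℚ
  L0 = let a , Ua = X.U-inhabited in a , Ua , small ≤-refl Ua

  dis : ∀ {s} → L′ s → U′ s → ⊥
  dis {s} (b , Ub , sb<1) (a , 0<a , La , 1<as) with 0ℚ <? s
  ... | yes 0<s = <-asym (<-trans 1<as (*-monoˡ-<-pos s {{positive 0<s}} (X.L<U La Ub)))
                         (subst (_< 1ℚ) (*-comm s b) sb<1)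
  ... | no  0≮s = <-asym 0<1 (<-≤-trans 1<as
                    (subst (a * s ≤_) (*-zeroʳ a)
                      (*-monoˡ-≤-nonNeg a {{nonNegative (<⇒≤ 0<a)}} (≮⇒≥ 0≮s))))

  loc : ∀ {s t} → s < t → L′ s ⊎ U′ t
  loc {s} {t} s<t with 0ℚ <? s
  ... | no  0≮s = let a , Ua = X.U-inhabited in inj₁ (a , Ua , small (≮⇒≥ 0≮s) Ua)
  ... | yes 0<s with recip s 0<s | recip t (<-trans 0<s s<t)
  ... | 1/s , 0<1/s , 1/s*s≡1 | 1/t , 0<1/t , 1/t*t≡1 with 1/t <? 1/s
  ... | no  1/t≮1/s = ⊥-elim (<-irrefl (trans 1/s*s≡1 (sym 1/t*t≡1))
                        (≤-<-trans (*-monoʳ-≤-nonNeg s {{nonNegative (<⇒≤ 0<s)}} (≮⇒≥ 1/t≮1/s))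
                                   (*-monoʳ-<-pos 1/t {{positive 0<1/t}} s<t)))
  ... | yes 1/t<1/s with dense 1/t<1/s
  ... | u , 1/t<u , u<1/s with dense u<1/s
  ... | v , u<v , v<1/s with X.located u<v
  ... | inj₁ Lu = inj₂ (u , <-trans 0<1/t 1/t<u , Lu ,
                    subst (_< u * t) 1/t*t≡1 (*-monoˡ-<-pos t {{positive (<-trans 0<s s<t)}} 1/t<u))
  ... | inj₂ Uv = inj₁ (v , Uv ,
                    subst (s * v <_) (trans (*-comm s 1/s) 1/s*s≡1)
                      (*-monoʳ-<-pos s {{positive 0<s}} v<1/s))

_÷ᴿ_ : ℝ⁺ → ℝ⁺ → ℝ⁺
x ÷ᴿ y = x *ᴿ y ⁻¹

-- The k-th root of c.  Asking for u strictly beyond s makes the cut open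
-- without appeal to continuity of u ↦ uᵏ.
root : (k : ℕ) .{{_ : NonZero k}} (c : ℕ) .{{_ : NonZero c}} → ℝ⁺
root k c = record
  { L           = L′
  ; U           = U′
  ; L-inhabited = 0ℚ , L0
  ; U-inhabited = let 1<1+c = subst (_< 1ℚ + C) (+-identityʳ 1ℚ) (+-monoʳ-< 1ℚ 0<C)
                  in (1ℚ + C) + 1ℚ , 1ℚ + C , a<a+d (1ℚ + C) 0<1 , <-trans 0<1 1<1+c ,
                     <-≤-trans (subst (_< 1ℚ + C) (+-identityˡ C) (+-monoˡ-< C 0<1))
                               (t≤t^k k (<⇒≤ 1<1+c))
  ; L-lower     = λ s<t (u , t<u , p) → u , <-trans s<t t<u , p
  ; U-upper     = λ s<t (u , u<s , p) → u , <-trans u<s s<t , p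
  ; L-open      = λ (u , s<u , p) → let m , s<m , m<u = dense s<u in m , s<m , u , m<u , p
  ; U-open      = λ (u , u<t , p) → let m , u<m , m<t = dense u<t in m , m<t , u , u<m , p
  ; disjoint    = λ (u , s<u , 0<u , u^k<c) (v , v<s , 0<v , c<v^k) →
                  <-asym (<-trans u^k<c c<v^k) (^-mono-< k 0<v (<-trans v<s s<u))
  ; located     = loc
  } ,⁺ L0
  where
  C = + c / 1

  0<C : 0ℚ < C
  0<C = positive⁻¹ C {{normalize-pos c 1}}

  L′ U′ : ℚ → Set
  L′ s = ∃ λ u → s < u × 0ℚ < u × u ^ℚ k < C
  U′ s = ∃ λ u → u < s × 0ℚ < u × C < u ^ℚ k

  1≤C : 1ℚ ≤ C
  1≤C = toℚᵘ-cancel-≤ (ℚᵘ.≤-respʳ-≃ (ℚᵘ.≃-sym (toℚᵘ-fromℚᵘ (mkℚᵘ (+ c) 0)))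
          (ℚᵘ.*≤* (ℤ.*-monoʳ-≤-nonNeg (+ 1) (ℤ.+≤+ (ℕ.>-nonZero⁻¹ c)))))

  L0 : L′ 0ℚ
  L0 = let m , 0<m , m<1 = dense 0<1
       in m , 0<m , 0<m , <-≤-trans (subst (m ^ℚ k <_) (1^ k) (^-mono-< k 0<m m<1)) 1≤C

  loc : ∀ {s t} → s < t → L′ s ⊎ U′ t
  loc {s} {t} s<t with dense s<t
  ... | m , s<m , m<t with 0ℚ <? m
  ... | no  0≮m = let u , 0<u , p = L0 in inj₁ (u , <-trans (<-≤-trans s<m (≮⇒≥ 0≮m)) 0<u , p)
  ... | yes 0<m with m ^ℚ k <? C
  ... | yes m^k<C = inj₁ (m , s<m , 0<m , m^k<C)
  ... | no  m^k≮C with dense m<t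
  ... | m′ , m<m′ , m′<t =
    inj₂ (m′ , m′<t , <-trans 0<m m<m′ , ≤-<-trans (≮⇒≥ m^k≮C) (^-mono-< k 0<m m<m′))

infixr 8 _^ᴿ_

-- A rational is stored in lowest terms as m / suc d-1, and
-- b ^ (m / k) is the k-th root of b ^ m.
_^ᴿ_ : (b : ℕ) .{{_ : NonZero b}} → ℚ → ℝ⁺
b ^ᴿ mkℚ (+ m)    d-1 _ = root (suc d-1) (b ℕ.^ m) {{ℕ.m^n≢0 b m}}
b ^ᴿ mkℚ -[1+ m ] d-1 _ = root (suc d-1) (b ℕ.^ suc m) {{ℕ.m^n≢0 b (suc m)}} ⁻¹

∏ : ∀ {n} → Subset n → (Fin n → ℝ⁺) → ℝ⁺
∏ []            f = fromℕ⁺ 1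
∏ (inside  ∷ T) f = f zero *ᴿ ∏ T (λ i → f (suc i))
∏ (outside ∷ T) f = ∏ T (λ i → f (suc i))

syntax ∏ T (λ i → e) = ∏[ i ∈ T ] e

-- The vectors x = (x₁ , … , xₙ) with xᵢ in the pᵢ-element set Fin pᵢ.
S : ∀ {n} → Vec ℕ n → Set
S p = All Fin p

vectors : ∀ {n} (p : Vec ℕ n) → List (S p)
vectors []      = [] ∷ []
vectors (m ∷ p) = cartesianProductWith _∷_ (allFin m) (vectors p)

∣S_∣ : ∀ {n} → Vec ℕ n → ℕ
∣S p ∣ = length (vectors p)

∣S∣-nonZero : ∀ {n} (p : Vec ℕ n) → (∀ i → 2 ℕ.≤ lookup p i) → NonZero ∣S p ∣
∣S∣-nonZero p p≥2 = ℕ.>-nonZero (0<∣S∣ p p≥2)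
  where
  0<length : {X Y Z : Set} (f : X → Y → Z) (x : X) (xs : List X) (ys : List Y) →
             0 ℕ.< length ys → 0 ℕ.< length (cartesianProductWith f (x ∷ xs) ys)
  0<length f x xs (y ∷ ys) _ = ℕ.z<s

  0<∣S∣ : ∀ {n} (p : Vec ℕ n) → (∀ i → 2 ℕ.≤ lookup p i) → 0 ℕ.< ∣S p ∣
  0<∣S∣ []          _   = ℕ.z<s
  0<∣S∣ (zero  ∷ p) p≥2 with () ← p≥2 zero
  0<∣S∣ (suc m ∷ p) p≥2 =
    0<length _∷_ zero (List.tabulate suc) (vectors p) (0<∣S∣ p (λ i → p≥2 (suc i)))

Family : ∀ {n} → Vec ℕ n → Set
Family p = S p → Bool

infix 4 _∈ᶠ_

_∈ᶠ_ : ∀ {n} {p : Vec ℕ n} → S p → Family p → Set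
x ∈ᶠ A = T (A x)

∣_∣ : ∀ {n} {p : Vec ℕ n} → Family p → ℕ
∣_∣ {p = p} A = length (filterᵇ A (vectors p))

agreement : ∀ {n} {p : Vec ℕ n} → S p → S p → Subset n
agreement x y = tabulate λ i → does (lookup⁺ x i Fin.≟ lookup⁺ y i)

Intersecting : ∀ {n} {p : Vec ℕ n} → ℕ → S p → S p → Set
Intersecting r x y = r ℕ.≤ size (agreement x y)

CrossIntersecting : ∀ {n} {p : Vec ℕ n} → ℕ → Family p → Family p → Set
CrossIntersecting r A B = ∀ x y → x ∈ᶠ A → y ∈ᶠ B → Intersecting r x y

MaximalPair : ∀ {n} {p : Vec ℕ n} → ℕ → Family p → Family p → Set
MaximalPair {p = p} r A B =
  CrossIntersecting r A B ×
  ((A′ B′ : Family p) → CrossIntersecting r A′ B′ → ∣ A′ ∣ ℕ.* ∣ B′ ∣ ℕ.≤ ∣ A ∣ ℕ.* ∣ B ∣)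

Irrelevant : ∀ {n} {p : Vec ℕ n} → Fin n → Family p → Set
Irrelevant i A = ∀ x y → (∀ j → j ≢ i → lookup⁺ x j ≡ lookup⁺ y j) → x ∈ᶠ A → y ∈ᶠ A

Relevant : ∀ {n} {p : Vec ℕ n} → Fin n → Family p → Set
Relevant i A = ¬ Irrelevant i A

factor : (m : ℕ) → 2 ℕ.≤ m → ℝ⁺
factor m 2≤m = (m ℕ.∸ 1) ^ᴿ (1ℚ - + 2 / m)
  where instance
    _ : NonZero m
    _ = ℕ.>-nonZero (ℕ.≤-trans (s≤s z≤n) 2≤m)
    _ : NonZero (m ℕ.∸ 1)
    _ = ℕ.>-nonZero (ℕ.∸-monoˡ-≤ 1 2≤m)

{-# OPTIONS --safe #-}

-- Let A_l be the fibre of A over x_i = l. For l ≠ k the pair ([p_i] × A_l , [p_i] × B_k) is again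
-- r-cross-intersecting, so by maximality p_i² |A_l| |B_k| ≤ |A| |B|. Summing over k (and over l) gives a
-- quadratic inequality for the most popular value l: either all fibres of A and all fibres of B have the
-- same size, or |A_l| ≥ (1 − 1/p_i) |A| and |B_l| ≥ (1 − 1/p_i) |B|. In the first case, if p_i ≥ 3, the
-- pairs ([p_i] × A_l , [p_i] × (B_j ∪ B_k)) show that B_j = B_k, and likewise for A, so i is irrelevant;
-- if p_i = 2, the first case is contained in the second.
--
-- Hence every relevant i has a popular value l_i. The entropy bound is obtained by AM-GM: give x ∈ S_p the weight
-- W(x) = ∏ (p_i − 1)², over the relevant i with x_i = l_i. The sum of W over S_p is |S_p| ∏ (p_i − 1),
-- while the product of W over A is ∏ (p_i − 1)^(2 d_i) with d_i = #{x ∈ A : x_i = l_i} ≥ (1 − 1/p_i) |A|.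
module Submission where

open import Defs
open import Algebra.Bundles using (module CommutativeRing)
open import Data.Bool.Base using (Bool; true; false; T; if_then_else_; _∧_; _∨_)
open import Data.Fin.Base using (Fin; zero; suc; punchIn; punchOut)
open import Data.Fin.Properties using (_≟_; all?; punchInᵢ≢i; punchIn-injective; punchIn-punchOut)
open import Data.Fin.Subset using (Subset; _∈_; _⊆_; ⊤; inside; outside) renaming (∣_∣ to size)
open import Data.Fin.Subset.Properties using (_∈?_; p⊆q⇒∣p∣≤∣q∣; ∣⊤∣≡n)
open import Data.Integer.Base as ℤ using (-[1+_])
import Data.Integer.Properties as ℤ
open import Data.List.Base using (List; []; _∷_; length; map; filterᵇ; cartesianProductWith; tabulate)
open import Data.List.Properties using (length-map; map-++; map-∘)
open import Data.Nat.Base using (ℕ; zero; suc; _+_; _*_; _∸_; _^_; _≤_; _<_; z≤n; s≤s; NonZero; >-nonZero; >-nonZero⁻¹)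
open import Data.Nat.ListAction using (sum; product)
open import Data.Nat.ListAction.Properties using (sum-++)
open import Data.Nat.Properties hiding (_≟_)
open import Data.Nat.Tactic.RingSolver using (solve-∀)
open import Data.Product.Base using (∃; _×_; _,_; proj₁; proj₂)
open import Data.Rational.Base as ℚ using (ℚ; mkℚ; 0ℚ; 1ℚ; toℚᵘ; positive; nonNegative)
import Data.Rational.Properties as ℚ
import Data.Rational.Solver as ℚ
open import Data.Rational.Unnormalised.Base as ℚᵘ using (mkℚᵘ; *≡*; *≤*)
import Data.Rational.Unnormalised.Properties as ℚᵘ
open import Data.Sum.Base as Sum using (_⊎_; inj₁; inj₂; [_,_]′)
open import Data.Vec.Base using (Vec; []; _∷_; lookup)
open import Data.Vec.Properties using (lookup∘tabulate; []=⇒lookup; lookup⇒[]=)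
open import Data.Vec.Relation.Unary.All using ([]; _∷_)
open import Data.Vec.Relation.Unary.All.Properties using (lookup⁺; lookup⁻)
open import Function.Base using (_∘_; id)
open import Function.Bundles using (_⇔_; Equivalence)
open import Relation.Binary.PropositionalEquality
open import Relation.Nullary using (Dec; yes; no; contradiction; does)
open import Relation.Nullary.Decidable using (dec-true)

open import Algebra.Properties.Semiring.Sum +-*-semiring
  using (sum-syntax; sum-cong-≗; ∑-comm; sum-remove; *-distribˡ-sum; *-distribʳ-sum)
  renaming (sum to ∑)
open import Algebra.Properties.CommutativeMonoid.Sum *-1-commutativeMonoid using ()
  renaming (sum to prod; sum-cong-≗ to prod-cong; ∑-distrib-+ to prod-distrib-*)
open import Algebra.Properties.CommutativeSemiring.Exp
  (CommutativeRing.commutativeSemiring ℚ.+-*-commutativeRing) using ()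
  renaming (^-assocʳ to ^ℚ-*-assoc; ^-distrib-* to ^ℚ-distrib-*)

-- Inequalities in `ℕ`: AM-GM and the dichotomy

^-distribʳ-* : ∀ m n o → (n * o) ^ m ≡ n ^ m * o ^ m
^-distribʳ-* zero    n o = refl
^-distribʳ-* (suc m) n o = trans (cong (n * o *_) (^-distribʳ-* m n o)) (interchange n o (n ^ m) (o ^ m))
  where
  interchange : ∀ a b c d → a * b * (c * d) ≡ a * c * (b * d)
  interchange = solve-∀

2mn≤m²+n² : ∀ m n → 2 * (m * n) ≤ m * m + n * n
2mn≤m²+n² m n =
  [ ordered
  , (λ n≤m → subst₂ _≤_ (cong (2 *_) (*-comm n m)) (+-comm (n * n) (m * m)) (ordered n≤m))
  ]′ (≤-total m n)
  where
  identity : ∀ m d → m * m + (m + d) * (m + d) ≡ 2 * (m * (m + d)) + d * d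
  identity = solve-∀

  ordered : ∀ {m n} → m ≤ n → 2 * (m * n) ≤ m * m + n * n
  ordered {m} m≤n with m≤n⇒∃[o]m+o≡n m≤n
  ... | d , refl = ≤-trans (m≤m+n _ (d * d)) (≤-reflexive (sym (identity m d)))

young : ∀ k m t → suc k * (m * t ^ k) ≤ m ^ suc k + k * t ^ suc k
young zero    m t = ≤-reflexive (identity m)
  where
  identity : ∀ m → 1 * (m * 1) ≡ m * 1 + 0
  identity = solve-∀
young (suc k) m t = +-cancelʳ-≤ (k * (m * (t * t ^ k))) _ _ (begin
  suc (suc k) * (m * (t * t ^ k)) + k * (m * (t * t ^ k))
    ≡⟨ split k m t (t ^ k) ⟩
  suc k * t ^ k * (2 * (m * t))
    ≤⟨ *-monoʳ-≤ (suc k * t ^ k) (2mn≤m²+n² m t) ⟩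
  suc k * t ^ k * (m * m + t * t)
    ≡⟨ expand k m t (t ^ k) ⟩
  m * (suc k * (m * t ^ k)) + suc k * (t * (t * t ^ k))
    ≤⟨ +-monoˡ-≤ _ (*-monoʳ-≤ m (young k m t)) ⟩
  m * (m ^ suc k + k * t ^ suc k) + suc k * (t * (t * t ^ k))
    ≡⟨ collect k m t (t ^ k) (m ^ suc k) ⟩
  (m * m ^ suc k + suc k * (t * (t * t ^ k))) + k * (m * (t * t ^ k)) ∎)
  where
  open ≤-Reasoning

  split : ∀ k m t T → suc (suc k) * (m * (t * T)) + k * (m * (t * T)) ≡ suc k * T * (2 * (m * t))
  split = solve-∀

  expand : ∀ k m t T → suc k * T * (m * m + t * t) ≡ m * (suc k * (m * T)) + suc k * (t * (t * T))
  expand = solve-∀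

  collect : ∀ k m t T M → m * (M + k * (t * T)) + suc k * (t * (t * T)) ≡
                          (m * M + suc k * (t * (t * T))) + k * (m * (t * T))
  collect = solve-∀

-- Weighted AM-GM for k copies of s / k and one w, with denominators cleared.
amgm-step : ∀ k .{{_ : NonZero k}} s w → suc k ^ suc k * (s ^ k * w) ≤ k ^ k * (s + w) ^ suc k
amgm-step k s w = *-cancelˡ-≤ k (+-cancelʳ-≤ (k * t ^ suc k) _ _ (begin
  k * (suc k ^ suc k * (s ^ k * w)) + k * t ^ suc k
    ≡⟨ cong (_+ k * t ^ suc k) (trans (regroup k (suc k ^ k) (s ^ k) w)
         (cong (λ z → k * (suc k * (w * z))) (sym (^-distribʳ-* k (suc k) s)))) ⟩
  k * (suc k * (w * t ^ k)) + k * t ^ suc k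
    ≡⟨ identity k s w (t ^ k) ⟩
  suc k * (k * (s + w) * t ^ k)
    ≤⟨ young k (k * (s + w)) t ⟩
  (k * (s + w)) ^ suc k + k * t ^ suc k
    ≡⟨ cong (_+ k * t ^ suc k) (trans (^-distribʳ-* (suc k) k (s + w)) (*-assoc k (k ^ k) _)) ⟩
  k * (k ^ k * (s + w) ^ suc k) + k * t ^ suc k ∎))
  where
  open ≤-Reasoning

  -- `young` is an equality when its two bases coincide; `k * (s + w) = t` amounts to `k * w = s`,
  -- the equality case of AM-GM.
  t : ℕ
  t = suc k * s

  regroup : ∀ k C s w → k * (suc k * C * (s * w)) ≡ k * (suc k * (w * (C * s)))
  regroup = solve-∀

  identity : ∀ k s w T → k * (suc k * (w * T)) + k * (suc k * s * T) ≡ suc k * (k * (s + w) * T)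
  identity = solve-∀

-- Induction on the list, the head joining the tail through `amgm-step` after multiplication by
-- `k ^ k`. A singleton is a base case of its own because `amgm-step` asks for a nonzero `k`.
am-gm : ∀ ws → length ws ^ length ws * product ws ≤ sum ws ^ length ws
am-gm []       = ≤-refl
am-gm (w ∷ []) = ≤-reflexive (identity w)
  where
  identity : ∀ w → 1 * 1 * (w * 1) ≡ (w + 0) * 1
  identity = solve-∀
am-gm (w ∷ ws@(_ ∷ _)) = *-cancelˡ-≤ (k ^ k) {{m^n≢0 k k}} (begin
  k ^ k * (suc k ^ suc k * (w * product ws))
    ≡⟨ regroup (k ^ k) (suc k ^ suc k) w (product ws) ⟩
  suc k ^ suc k * (k ^ k * product ws * w)
    ≤⟨ *-monoʳ-≤ (suc k ^ suc k) (*-monoˡ-≤ w (am-gm ws)) ⟩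
  suc k ^ suc k * (sum ws ^ k * w)
    ≤⟨ amgm-step k (sum ws) w ⟩
  k ^ k * (sum ws + w) ^ suc k
    ≡⟨ cong (λ z → k ^ k * z ^ suc k) (+-comm (sum ws) w) ⟩
  k ^ k * (w + sum ws) ^ suc k ∎)
  where
  open ≤-Reasoning

  k : ℕ
  k = length ws

  regroup : ∀ K C w P → K * (C * (w * P)) ≡ C * (K * P * w)
  regroup = solve-∀

^-cancelˡ-≤ : ∀ k .{{_ : NonZero k}} {m n} → m ^ k ≤ n ^ k → m ≤ n
^-cancelˡ-≤ k m^k≤n^k = ≮⇒≥ λ n<m → <⇒≱ (^-monoˡ-< k n<m) m^k≤n^k

-- With X = x / a ≤ Y = y / b and m = 1 + c, the last hypothesis is Y (m − X) ≤ c,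
-- whence X (m − X) ≤ c, that is (X − 1) (X − c) ≥ 0.
dichotomy : ∀ c a b x y .{{_ : NonZero c}} .{{_ : NonZero a}} .{{_ : NonZero b}} →
            a ≤ x → x * b ≤ y * a → suc c * (y * a) ≤ x * y + c * (a * b) →
            (x ≡ a × y ≡ b) ⊎ (c * a ≤ x × c * b ≤ y)
dichotomy c a b x y a≤x xb≤ya h with m≤n⇒m<n∨m≡n a≤x | c * a ≤? x
... | _         | yes ca≤x = inj₂ (ca≤x , *-cancelʳ-≤ (c * b) y a (begin
  c * b * a ≡⟨ regroup c b a ⟩
  c * a * b ≤⟨ *-monoˡ-≤ b ca≤x ⟩
  x * b     ≤⟨ xb≤ya ⟩
  y * a     ∎))
  where
  open ≤-Reasoning
  regroup : ∀ c b a → c * b * a ≡ c * a * b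
  regroup = solve-∀
... | inj₂ refl | no _ = inj₁ (refl , ≤-antisym y≤b b≤y)
  where
  open ≤-Reasoning
  b≤y : b ≤ y
  b≤y = *-cancelˡ-≤ a (≤-trans xb≤ya (≤-reflexive (*-comm y a)))

  y≤b : y ≤ b
  y≤b = *-cancelˡ-≤ (c * a) {{m*n≢0 c a}} (+-cancelʳ-≤ (a * y) _ _ (begin
    c * a * y + a * y     ≡⟨ left c a y ⟩
    suc c * (y * a)       ≤⟨ h ⟩
    a * y + c * (a * b)   ≡⟨ right c a b (a * y) ⟩
    c * a * b + a * y     ∎))
    where
    left : ∀ c a y → c * a * y + a * y ≡ suc c * (y * a)
    left = solve-∀
    right : ∀ c a b z → z + c * (a * b) ≡ c * a * b + z
    right = solve-∀
... | inj₁ a<x  | no ca≰x with m≤n⇒∃[o]m+o≡n (<⇒≤ a<x) | m≤n⇒∃[o]m+o≡n (<⇒≤ (≰⇒> ca≰x))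
-- Now `u = x - a` and `v = c * a - x` are positive, and `a + v` is `suc c * a - x`. Cleared of
-- denominators, X (m - X) ≤ c reads `x * (a + v) ≤ (x + v) * a`, which leaves no room for `u * v`.
... | u , refl | v , x+v≡ca = contradiction uv≤0 (<⇒≱ 0<uv)
  where
  open ≤-Reasoning
  0<uv : 0 < u * v
  0<uv = *-mono-≤ (+-cancelˡ-< a 0 u (subst (_< a + u) (sym (+-identityʳ a)) a<x))
                  (+-cancelˡ-< x 0 v (subst₂ _<_ (sym (+-identityʳ x)) (sym x+v≡ca) (≰⇒> ca≰x)))

  y[a+v]≤cab : y * (a + v) ≤ c * (a * b)
  y[a+v]≤cab = +-cancelˡ-≤ (x * y) _ _ (begin
    x * y + y * (a + v)       ≡⟨ left x y a v ⟩
    y * a + (x + v) * y       ≡⟨ cong (λ z → y * a + z * y) x+v≡ca ⟩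
    y * a + c * a * y         ≡⟨ right y a c ⟩
    suc c * (y * a)           ≤⟨ h ⟩
    x * y + c * (a * b)       ∎)
    where
    left : ∀ x y a v → x * y + y * (a + v) ≡ y * a + (x + v) * y
    left = solve-∀
    right : ∀ y a c → y * a + c * a * y ≡ suc c * (y * a)
    right = solve-∀

  x[a+v]≤[x+v]a : x * (a + v) ≤ (x + v) * a
  x[a+v]≤[x+v]a = *-cancelˡ-≤ b (begin
    b * (x * (a + v))   ≡⟨ *-assoc b x (a + v) ⟨
    b * x * (a + v)     ≡⟨ cong (_* (a + v)) (*-comm b x) ⟩
    x * b * (a + v)     ≤⟨ *-monoˡ-≤ (a + v) xb≤ya ⟩
    y * a * (a + v)     ≡⟨ left y a (a + v) ⟩
    a * (y * (a + v))   ≤⟨ *-monoʳ-≤ a y[a+v]≤cab ⟩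
    a * (c * (a * b))   ≡⟨ right a b c ⟩
    b * (c * a * a)     ≡⟨ cong (λ z → b * (z * a)) x+v≡ca ⟨
    b * ((x + v) * a)   ∎)
    where
    left : ∀ y a z → y * a * z ≡ a * (y * z)
    left = solve-∀
    right : ∀ a b c → a * (c * (a * b)) ≡ b * (c * a * a)
    right = solve-∀

  uv≤0 : u * v ≤ 0
  uv≤0 = +-cancelˡ-≤ ((a + u + v) * a) _ _ (begin
    (a + u + v) * a + u * v   ≡⟨ identity a u v ⟩
    (a + u) * (a + v)         ≤⟨ x[a+v]≤[x+v]a ⟩
    (a + u + v) * a           ≡⟨ +-identityʳ _ ⟨
    (a + u + v) * a + 0       ∎)
    where
    identity : ∀ a u v → (a + u + v) * a + u * v ≡ (a + u) * (a + v)
    identity = solve-∀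

-- Sums over `Fin n` and the sizes of fibres

∑-const : ∀ n c → ∑[ i < n ] c ≡ n * c
∑-const zero    c = refl
∑-const (suc n) c = cong (c +_) (∑-const n c)

∑-mono : ∀ {n} {f g : Fin n → ℕ} → (∀ i → f i ≤ g i) → ∑ f ≤ ∑ g
∑-mono {zero}  f≤g = z≤n
∑-mono {suc n} f≤g = +-mono-≤ (f≤g zero) (∑-mono (f≤g ∘ suc))

-- Slack in one term cannot be compensated by the others. This drives every equality case below, for
-- numbers and, via indicators, for families.
∑-mono-rigid : ∀ {n} {f g : Fin n → ℕ} → (∀ i → f i ≤ g i) → ∑ g ≤ ∑ f → ∀ i → g i ≤ f i
∑-mono-rigid {suc n} {f} {g} f≤g ∑g≤∑f zero = +-cancelʳ-≤ (∑ (f ∘ suc)) (g zero) (f zero)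
  (≤-trans (+-monoʳ-≤ (g zero) (∑-mono (f≤g ∘ suc))) ∑g≤∑f)
∑-mono-rigid {suc n} {f} {g} f≤g ∑g≤∑f (suc i) = ∑-mono-rigid (f≤g ∘ suc)
  (+-cancelˡ-≤ (f zero) _ _ (≤-trans (+-monoˡ-≤ (∑ (g ∘ suc)) (f≤g zero)) ∑g≤∑f)) i

∑-constʳ : ∀ {c} (f : Fin (suc c) → ℕ) l {z} → (∀ k → k ≢ l → f k ≡ z) → ∑ f ≡ f l + c * z
∑-constʳ {c} f l {z} f≡z = trans (sum-remove f)
  (cong (f l +_) (trans (sum-cong-≗ (λ j → f≡z (punchIn l j) (punchInᵢ≢i l j))) (∑-const c z)))

∑-≤ʳ : ∀ {c} (f : Fin (suc c) → ℕ) l {z} → (∀ k → k ≢ l → f k ≤ z) → ∑ f ≤ f l + c * z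
∑-≤ʳ {c} f l {z} f≤z = subst (_≤ f l + c * z) (sym (sum-remove f))
  (+-monoʳ-≤ (f l) (≤-trans (∑-mono (λ j → f≤z (punchIn l j) (punchInᵢ≢i l j))) (≤-reflexive (∑-const c z))))

argmax : ∀ {n} (f : Fin (suc n) → ℕ) → ∃ λ l → ∀ k → f k ≤ f l
argmax {zero}  f = zero , λ { zero → ≤-refl }
argmax {suc n} f with argmax (f ∘ suc)
... | l , max with ≤-total (f zero) (f (suc l))
... | inj₁ f₀≤ = suc l , λ { zero → f₀≤ ; (suc k) → max k }
... | inj₂ ≤f₀ = zero  , λ { zero → ≤-refl ; (suc k) → ≤-trans (max k) ≤f₀ }

-- `α` and `β` stand for the fibre sizes, with means `a` and `b`. For `l` maximizing `α`, summing
-- the product bound over one index with the other fixed at `l` gives `xb-bound` and `ya-bound`, the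
-- quadratic inequalities that `dichotomy` resolves.
concentrated-or-constant : ∀ m → 2 ≤ m → ∀ {a b} .{{_ : NonZero a}} .{{_ : NonZero b}} {α β : Fin m → ℕ} →
  ∑ α ≡ m * a → ∑ β ≡ m * b → (∀ l k → k ≢ l → α l * β k ≤ a * b) →
  (∃ λ l → (m ∸ 1) * a ≤ α l × (m ∸ 1) * b ≤ β l) ⊎ (∀ l → α l ≡ a × β l ≡ b)
concentrated-or-constant (suc c@(suc _)) (s≤s (s≤s _)) {a} {b} {α} {β} ∑α ∑β αβ≤ab with argmax α
... | l , max = [ (λ (x≡a , y≡b) → inj₂ (constant x≡a y≡b)) , (λ large → inj₁ (l , large)) ]′ dichotomous
  where
  open ≤-Reasoning
  x y : ℕ
  x = α l
  y = β l

  a≤x : a ≤ x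
  a≤x = *-cancelˡ-≤ (suc c) (begin
    suc c * a            ≡⟨ ∑α ⟨
    ∑ α                  ≤⟨ ∑-mono max ⟩
    ∑[ k < suc c ] x     ≡⟨ ∑-const (suc c) x ⟩
    suc c * x            ∎)

  xb-bound : suc c * (x * b) ≤ x * y + c * (a * b)
  xb-bound = begin
    suc c * (x * b)                ≡⟨ regroup (suc c) x b ⟩
    x * (suc c * b)                ≡⟨ cong (x *_) ∑β ⟨
    x * ∑ β                        ≡⟨ *-distribˡ-sum x β ⟩
    ∑[ k < suc c ] (x * β k)       ≤⟨ ∑-≤ʳ (λ k → x * β k) l (λ k k≢l → αβ≤ab l k k≢l) ⟩
    x * y + c * (a * b)            ∎
    where
    regroup : ∀ d x b → d * (x * b) ≡ x * (d * b)
    regroup = solve-∀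

  ya-bound : suc c * (y * a) ≤ x * y + c * (a * b)
  ya-bound = begin
    suc c * (y * a)                ≡⟨ regroup (suc c) y a ⟩
    suc c * a * y                  ≡⟨ cong (_* y) ∑α ⟨
    ∑ α * y                        ≡⟨ *-distribʳ-sum y α ⟩
    ∑[ k < suc c ] (α k * y)       ≤⟨ ∑-≤ʳ (λ k → α k * y) l (λ k k≢l → αβ≤ab k l (k≢l ∘ sym)) ⟩
    x * y + c * (a * b)            ∎
    where
    regroup : ∀ d y a → d * (y * a) ≡ d * a * y
    regroup = solve-∀

  -- Only `α` was maximized at `l`; that `β l` is at least its mean comes from replacing `a` by `x`
  -- on the right of `xb-bound`.
  b≤y : b ≤ y
  b≤y = *-cancelˡ-≤ x {{>-nonZero (≤-trans (>-nonZero⁻¹ a) a≤x)}}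
    (+-cancelʳ-≤ (c * (x * b)) _ _ (≤-trans xb-bound (+-monoʳ-≤ (x * y) (*-monoʳ-≤ c (*-monoˡ-≤ b a≤x)))))

  -- `dichotomy` takes the smaller of the ratios x / a and y / b first, so the two sides may have to
  -- be swapped.
  dichotomous : (x ≡ a × y ≡ b) ⊎ (c * a ≤ x × c * b ≤ y)
  dichotomous with ≤-total (x * b) (y * a)
  ... | inj₁ xb≤ya = dichotomy c a b x y a≤x xb≤ya ya-bound
  ... | inj₂ ya≤xb = Sum.map (λ (p , q) → q , p) (λ (p , q) → q , p)
    (dichotomy c b a y x b≤y ya≤xb
      (subst₂ (λ u v → suc c * (x * b) ≤ u + c * v) (*-comm x y) (*-comm a b) xb-bound))

  constant : x ≡ a → y ≡ b → ∀ k → α k ≡ a × β k ≡ b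
  constant x≡a y≡b k =
    ≤-antisym (α≤a k) (∑-mono-rigid α≤a (≤-reflexive (trans (∑-const (suc c) a) (sym ∑α))) k) ,
    ≤-antisym (β≤b k) (∑-mono-rigid β≤b (≤-reflexive (trans (∑-const (suc c) b) (sym ∑β))) k)
    where
    α≤a : ∀ k → α k ≤ a
    α≤a k = subst (α k ≤_) x≡a (max k)

    β≤b : ∀ k → β k ≤ b
    β≤b k with k ≟ l
    ... | yes refl = ≤-reflexive y≡b
    ... | no  k≢l  = *-cancelˡ-≤ a (subst (λ z → z * β k ≤ a * b) x≡a (αβ≤ab l k k≢l))

-- Sums over S p

-- Iterated by coordinates rather than taken over the list `vectors p`, so that a single coordinate
-- can be summed out; `sum-vectors` reconciles the two.
∑S : ∀ {n} (p : Vec ℕ n) → (S p → ℕ) → ℕ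
∑S []      f = f []
∑S (m ∷ p) f = ∑[ j < m ] ∑S p (λ x → f (j ∷ x))

∑S-cong : ∀ {n} (p : Vec ℕ n) {f g : S p → ℕ} → (∀ x → f x ≡ g x) → ∑S p f ≡ ∑S p g
∑S-cong []      f≡g = f≡g []
∑S-cong (m ∷ p) f≡g = sum-cong-≗ (λ j → ∑S-cong p (λ x → f≡g (j ∷ x)))

∑S-mono : ∀ {n} (p : Vec ℕ n) {f g : S p → ℕ} → (∀ x → f x ≤ g x) → ∑S p f ≤ ∑S p g
∑S-mono []      f≤g = f≤g []
∑S-mono (m ∷ p) f≤g = ∑-mono (λ j → ∑S-mono p (λ x → f≤g (j ∷ x)))

∑S-mono-rigid : ∀ {n} (p : Vec ℕ n) {f g : S p → ℕ} →
                (∀ x → f x ≤ g x) → ∑S p g ≤ ∑S p f → ∀ x → g x ≤ f x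
∑S-mono-rigid []      f≤g ∑g≤∑f []      = ∑g≤∑f
∑S-mono-rigid (m ∷ p) f≤g ∑g≤∑f (j ∷ x) = ∑S-mono-rigid p (λ x → f≤g (j ∷ x))
  (∑-mono-rigid (λ j → ∑S-mono p (λ x → f≤g (j ∷ x))) ∑g≤∑f j) x

∑S-zero : ∀ {n} (p : Vec ℕ n) → ∑S p (λ _ → 0) ≡ 0
∑S-zero []      = refl
∑S-zero (m ∷ p) = trans (sum-cong-≗ {m} (λ _ → ∑S-zero p)) (trans (∑-const m 0) (*-zeroʳ m))

*-distribˡ-∑S : ∀ {n} (p : Vec ℕ n) c f → c * ∑S p f ≡ ∑S p (λ x → c * f x)
*-distribˡ-∑S []      c f = refl
*-distribˡ-∑S (m ∷ p) c f = trans (*-distribˡ-sum {m} c _) (sum-cong-≗ {m} (λ j → *-distribˡ-∑S p c _))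

-- The enumeration `h` is arbitrary because the induction passes from `h` to `h ∘ suc`; `allFin m`
-- is the case `h = id`.
sum-cartesianProductWith : ∀ {X Y Z : Set} {m} (g : X → Y → Z) (h : Fin m → X) (ys : List Y) (f : Z → ℕ) →
  sum (map f (cartesianProductWith g (tabulate h) ys)) ≡ ∑[ j < m ] sum (map (λ y → f (g (h j) y)) ys)
sum-cartesianProductWith {m = zero}  g h ys f = refl
sum-cartesianProductWith {m = suc m} g h ys f =
  trans (cong sum (map-++ f (map (g (h zero)) ys) _))
  (trans (sum-++ (map f (map (g (h zero)) ys)) _)
    (cong₂ _+_ (cong sum (sym (map-∘ ys))) (sum-cartesianProductWith g (h ∘ suc) ys f)))

sum-vectors : ∀ {n} (p : Vec ℕ n) f → sum (map f (vectors p)) ≡ ∑S p f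
sum-vectors []      f = +-identityʳ (f [])
sum-vectors (m ∷ p) f = trans (sum-cartesianProductWith {m = m} _∷_ id (vectors p) f)
  (sum-cong-≗ {m} (λ j → sum-vectors p (λ x → f (j ∷ x))))

∣S∣-∑S : ∀ {n} (p : Vec ℕ n) → ∣S p ∣ ≡ ∑S p (λ _ → 1)
∣S∣-∑S p = trans (length-sum (vectors p)) (sum-vectors p (λ _ → 1))
  where
  length-sum : {X : Set} (xs : List X) → length xs ≡ sum (map (λ _ → 1) xs)
  length-sum []       = refl
  length-sum (x ∷ xs) = cong suc (length-sum xs)

-- Cardinalities as sums of indicators

𝟙 : Bool → ℕ
𝟙 b = if b then 1 else 0

𝟙-mono : ∀ {b c} → (T b → T c) → 𝟙 b ≤ 𝟙 c
𝟙-mono {false}         b⇒c = z≤n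
𝟙-mono {true}  {true}  b⇒c = ≤-refl
𝟙-mono {true}  {false} b⇒c with () ← b⇒c _

𝟙-cancel : ∀ {b c} → 𝟙 b ≤ 𝟙 c → T b → T c
𝟙-cancel {true} {true} _ _ = _

∣∣-∑S : ∀ {n} {p : Vec ℕ n} (A : Family p) → ∣ A ∣ ≡ ∑S p (𝟙 ∘ A)
∣∣-∑S {p = p} A = trans (length-filterᵇ (vectors p)) (sum-vectors p (𝟙 ∘ A))
  where
  length-filterᵇ : ∀ xs → length (filterᵇ A xs) ≡ sum (map (𝟙 ∘ A) xs)
  length-filterᵇ []       = refl
  length-filterᵇ (x ∷ xs) with A x
  ... | true  = cong suc (length-filterᵇ xs)
  ... | false = length-filterᵇ xs

-- Rigidity of the indicator sums. Maximality is exploited in this form: an enlargement that does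
-- not increase the size adds no element.
⊆-rigid : ∀ {n} {p : Vec ℕ n} {F G : Family p} →
          (∀ x → x ∈ᶠ F → x ∈ᶠ G) → ∣ G ∣ ≤ ∣ F ∣ → ∀ x → x ∈ᶠ G → x ∈ᶠ F
⊆-rigid {p = p} {F} {G} F⊆G ∣G∣≤∣F∣ x = 𝟙-cancel (∑S-mono-rigid p (λ x → 𝟙-mono (F⊆G x))
  (subst₂ _≤_ (∣∣-∑S G) (∣∣-∑S F) ∣G∣≤∣F∣) x)

∈ᶠ⇒0<∣∣ : ∀ {n} {p : Vec ℕ n} {F : Family p} {x} → x ∈ᶠ F → 0 < ∣ F ∣
-- If `F` had size 0, rigidity against the empty family would place `x` in the latter.
∈ᶠ⇒0<∣∣ {p = p} {F} {x} x∈F = ≰⇒> λ ∣F∣≤0 → ⊆-rigid {F = λ _ → false} (λ _ ()) (subst (∣ F ∣ ≤_)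
  (sym (trans (∣∣-∑S {p = p} (λ _ → false)) (∑S-zero p))) ∣F∣≤0) x x∈F

-- Updates and fibres

infixl 6 _[_≔_]

_[_≔_] : ∀ {n} {p : Vec ℕ n} → S p → (i : Fin n) → Fin (lookup p i) → S p
(_ ∷ x) [ zero  ≔ l ] = l ∷ x
(v ∷ x) [ suc i ≔ l ] = v ∷ x [ i ≔ l ]

lookup-≔ : ∀ {n} {p : Vec ℕ n} (x : S p) i l → lookup⁺ (x [ i ≔ l ]) i ≡ l
lookup-≔ (_ ∷ x) zero    l = refl
lookup-≔ (v ∷ x) (suc i) l = lookup-≔ x i l

lookup-≔-≢ : ∀ {n} {p : Vec ℕ n} (x : S p) i l {j} → j ≢ i → lookup⁺ (x [ i ≔ l ]) j ≡ lookup⁺ x j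
lookup-≔-≢ (_ ∷ x) zero    l {zero}  j≢i = contradiction refl j≢i
lookup-≔-≢ (_ ∷ x) zero    l {suc j} j≢i = refl
lookup-≔-≢ (_ ∷ x) (suc i) l {zero}  j≢i = refl
lookup-≔-≢ (_ ∷ x) (suc i) l {suc j} j≢i = lookup-≔-≢ x i l (j≢i ∘ cong suc)

S-ext : ∀ {n} {p : Vec ℕ n} (x y : S p) → (∀ j → lookup⁺ x j ≡ lookup⁺ y j) → x ≡ y
S-ext []      []      _   = refl
S-ext (u ∷ x) (v ∷ y) x≗y = cong₂ _∷_ (x≗y zero) (S-ext x y (x≗y ∘ suc))

≔-agree : ∀ {n} {p : Vec ℕ n} (x y : S p) i →
          (∀ j → j ≢ i → lookup⁺ x j ≡ lookup⁺ y j) → x [ i ≔ lookup⁺ y i ] ≡ y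
≔-agree x y i x≗y = S-ext _ y pointwise
  where
  pointwise : ∀ j → lookup⁺ (x [ i ≔ lookup⁺ y i ]) j ≡ lookup⁺ y j
  pointwise j with j ≟ i
  ... | yes refl = lookup-≔ x i (lookup⁺ y i)
  ... | no  j≢i  = trans (lookup-≔-≢ x i _ j≢i) (x≗y j j≢i)

-- Double counting: every vector arises as `x [ i ≔ l ]` from exactly `lookup p i` pairs, since the
-- old value at `i` is forgotten.
∑-∑S-≔ : ∀ {n} (p : Vec ℕ n) i (f : S p → ℕ) →
         ∑[ l < lookup p i ] ∑S p (λ x → f (x [ i ≔ l ])) ≡ lookup p i * ∑S p f
∑-∑S-≔ (m ∷ p) zero    f = trans (∑-comm {m} {m} (λ l _ → ∑S p (λ x → f (l ∷ x)))) (∑-const m _)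
∑-∑S-≔ (m ∷ p) (suc i) f = trans (∑-comm {lookup p i} {m} (λ l j → ∑S p (λ x → f (j ∷ x [ i ≔ l ]))))
  (trans (sum-cong-≗ {m} (λ j → ∑-∑S-≔ p i (λ x → f (j ∷ x)))) (sym (*-distribˡ-sum {m} (lookup p i) _)))

-- [pᵢ] × {x′ : (x′ with l inserted at i) ∈ A}: the fibre of A over xᵢ = l, made independent of coordinate i.
fibre : ∀ {n} {p : Vec ℕ n} → Family p → (i : Fin n) → Fin (lookup p i) → Family p
fibre A i l x = A (x [ i ≔ l ])

-- The elements of `A` over `xᵢ = l` themselves, as opposed to the cylinder `fibre A i l` over them.
slice : ∀ {n} {p : Vec ℕ n} → Family p → (i : Fin n) → Fin (lookup p i) → Family p
slice A i l x = A x ∧ does (lookup⁺ x i ≟ l)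

∑-fibre : ∀ {n} {p : Vec ℕ n} (A : Family p) i → ∑[ l < lookup p i ] ∣ fibre A i l ∣ ≡ lookup p i * ∣ A ∣
∑-fibre {p = p} A i = trans (sum-cong-≗ (λ l → ∣∣-∑S (fibre A i l)))
  (trans (∑-∑S-≔ p i (𝟙 ∘ A)) (cong (lookup p i *_) (sym (∣∣-∑S A))))

-- Double counting for the indicator of the slice: only the update to `l` contributes, and there the
-- slice becomes the fibre.
∣fibre∣ : ∀ {n} {p : Vec ℕ n} (A : Family p) i l → ∣ fibre A i l ∣ ≡ lookup p i * ∣ slice A i l ∣
∣fibre∣ {p = p} A i l = sym (begin
  lookup p i * ∣ slice A i l ∣                      ≡⟨ cong (lookup p i *_) (∣∣-∑S (slice A i l)) ⟩
  lookup p i * ∑S p (𝟙 ∘ slice A i l)               ≡⟨ ∑-∑S-≔ p i (𝟙 ∘ slice A i l) ⟨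
  ∑[ k < lookup p i ] ∑S p (λ x → 𝟙 (slice A i l (x [ i ≔ k ])))
    ≡⟨ ∑-single l (λ k k≢l → trans (∑S-cong p (off k≢l)) (∑S-zero p)) ⟩
  ∑S p (λ x → 𝟙 (slice A i l (x [ i ≔ l ])))        ≡⟨ ∑S-cong p on ⟩
  ∑S p (𝟙 ∘ fibre A i l)                            ≡⟨ ∣∣-∑S (fibre A i l) ⟨
  ∣ fibre A i l ∣                                   ∎)
  where
  open ≡-Reasoning
  ∑-single : ∀ {m} {f : Fin m → ℕ} l → (∀ k → k ≢ l → f k ≡ 0) → ∑ f ≡ f l
  ∑-single {suc c} {f} l f≡0 = trans (∑-constʳ f l f≡0) (trans (cong (f l +_) (*-zeroʳ c)) (+-identityʳ (f l)))

  off : ∀ {k} → k ≢ l → ∀ x → 𝟙 (slice A i l (x [ i ≔ k ])) ≡ 0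
  off {k} k≢l x with A (x [ i ≔ k ]) | lookup⁺ (x [ i ≔ k ]) i ≟ l
  ... | false | _     = refl
  ... | true  | no _  = refl
  ... | true  | yes e = contradiction (trans (sym (lookup-≔ x i k)) e) k≢l

  on : ∀ x → 𝟙 (slice A i l (x [ i ≔ l ])) ≡ 𝟙 (fibre A i l x)
  on x with A (x [ i ≔ l ]) | lookup⁺ (x [ i ≔ l ]) i ≟ l
  ... | false | _     = refl
  ... | true  | yes _ = refl
  ... | true  | no ¬e = contradiction (lookup-≔ x i l) ¬e

-- Cross-intersecting families

module _ {n} {p : Vec ℕ n} (x y : S p) where

  ∈-agreement⁺ : ∀ {i} → lookup⁺ x i ≡ lookup⁺ y i → i ∈ agreement x y
  ∈-agreement⁺ {i} xᵢ≡yᵢ = lookup⇒[]= i _ (trans (lookup∘tabulate _ i) (dec-true (lookup⁺ x i ≟ lookup⁺ y i) xᵢ≡yᵢ))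

  ∈-agreement⁻ : ∀ {i} → i ∈ agreement x y → lookup⁺ x i ≡ lookup⁺ y i
  ∈-agreement⁻ {i} i∈
    with lookup⁺ x i ≟ lookup⁺ y i
       | trans (sym (lookup∘tabulate (λ i → does (lookup⁺ x i ≟ lookup⁺ y i)) i)) ([]=⇒lookup i∈)
  ... | yes e | _ = e

-- The updated vectors differ at `i`, so all their agreements lie at other coordinates, where the
-- original vectors agree as well.
cross-fibre : ∀ {n} {p : Vec ℕ n} {r} {A B : Family p} → CrossIntersecting r A B →
              ∀ i {l m} → l ≢ m → CrossIntersecting r (fibre A i l) (fibre B i m)
cross-fibre cross i {l} {m} l≢m x y x∈ y∈ = ≤-trans (cross _ _ x∈ y∈) (p⊆q⇒∣p∣≤∣q∣ agree)
  where
  agree : agreement (x [ i ≔ l ]) (y [ i ≔ m ]) ⊆ agreement x y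
  agree {j} j∈ with j ≟ i
  ... | yes refl = contradiction
    (trans (sym (lookup-≔ x i l)) (trans (∈-agreement⁻ (x [ i ≔ l ]) (y [ i ≔ m ]) j∈) (lookup-≔ y i m))) l≢m
  ... | no  j≢i  = ∈-agreement⁺ x y
    (trans (sym (lookup-≔-≢ x i l j≢i)) (trans (∈-agreement⁻ (x [ i ≔ l ]) (y [ i ≔ m ]) j∈) (lookup-≔-≢ y i m j≢i)))

_∪_ : ∀ {n} {p : Vec ℕ n} → Family p → Family p → Family p
(F ∪ G) x = F x ∨ G x

∪⁻ : ∀ {n} {p : Vec ℕ n} (F G : Family p) {x} → x ∈ᶠ F ∪ G → x ∈ᶠ F ⊎ x ∈ᶠ G
∪⁻ F G {x} x∈ with F x
... | true  = inj₁ _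
... | false = inj₂ x∈

∪⁺ˡ : ∀ {n} {p : Vec ℕ n} (F G : Family p) x → x ∈ᶠ F → x ∈ᶠ F ∪ G
∪⁺ˡ F G x x∈ with F x
... | true = _

∪⁺ʳ : ∀ {n} {p : Vec ℕ n} (F G : Family p) x → x ∈ᶠ G → x ∈ᶠ F ∪ G
∪⁺ʳ F G x x∈ with F x
... | true  = _
... | false = x∈

-- Comparison with the pair of families that both consist of `x₀` alone: its product of sizes is
-- positive, and it is `r`-cross-intersecting because `r ≤ n`.
maximal⇒nonEmpty : ∀ {n r} {p : Vec ℕ n} → r ≤ n → S p → {A B : Family p} →
                   MaximalPair r A B → NonZero ∣ A ∣ × NonZero ∣ B ∣
maximal⇒nonEmpty {n} {r} {p} r≤n x₀ {A} {B} (_ , max) =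
  (m*n≢0⇒m≢0 ∣ A ∣ {{product≢0}}) , (m*n≢0⇒n≢0 ∣ A ∣ {{product≢0}})
  where
  singleton : Family p
  singleton x = does (all? (λ i → lookup⁺ x i ≟ lookup⁺ x₀ i))

  singleton⁻ : ∀ x → x ∈ᶠ singleton → ∀ i → lookup⁺ x i ≡ lookup⁺ x₀ i
  singleton⁻ x = does⁻ (all? (λ i → lookup⁺ x i ≟ lookup⁺ x₀ i))
    where
    does⁻ : {P : Set} (P? : Dec P) → T (does P?) → P
    does⁻ (yes P) _ = P

  x₀∈singleton : x₀ ∈ᶠ singleton
  x₀∈singleton = subst T (sym (dec-true (all? (λ i → lookup⁺ x₀ i ≟ lookup⁺ x₀ i)) (λ _ → refl))) _

  cross : CrossIntersecting r singleton singleton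
  cross x y x∈ y∈ = ≤-trans r≤n (subst (_≤ size (agreement x y)) (∣⊤∣≡n n)
    (p⊆q⇒∣p∣≤∣q∣ {p = ⊤} (λ {i} _ → ∈-agreement⁺ x y (trans (singleton⁻ x x∈ i) (sym (singleton⁻ y y∈ i))))))

  product≢0 : NonZero (∣ A ∣ * ∣ B ∣)
  product≢0 = >-nonZero (≤-trans (*-mono-≤ {1} {_} {1} nonempty nonempty) (max singleton singleton cross))
    where
    nonempty : 0 < ∣ singleton ∣
    nonempty = ∈ᶠ⇒0<∣∣ {F = singleton} {x₀} x₀∈singleton

-- Popular values at relevant coordinates

origin : ∀ {n} {p : Vec ℕ n} → (∀ i → 2 ≤ lookup p i) → S p
origin p≥2 = lookup⁻ (λ i → first (p≥2 i))
  where
  first : ∀ {m} → 2 ≤ m → Fin m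
  first (s≤s _) = zero

-- The third value supplies a fibre of one family that can be paired with two fibres of the other.
-- For `j ≢ k`, `k` is avoided first, within the values other than `j`.
avoid₂ : ∀ {m} → 3 ≤ m → (j k : Fin m) → ∃ λ l → l ≢ j × l ≢ k
avoid₂ (s≤s (s≤s (s≤s _))) j k with j ≟ k
... | yes refl = punchIn j zero , punchInᵢ≢i j zero , punchInᵢ≢i j zero
... | no  j≢k  = punchIn j l′ , punchInᵢ≢i j l′ , λ e → punchInᵢ≢i (punchOut j≢k) zero
    (punchIn-injective j l′ (punchOut j≢k) (trans e (sym (punchIn-punchOut j≢k))))
  where
  l′ = punchIn (punchOut j≢k) zero

fibre-invariant⇒irrelevant : ∀ {n} {p : Vec ℕ n} {A : Family p} {i} →
  (∀ j k x → x ∈ᶠ fibre A i j → x ∈ᶠ fibre A i k) → Irrelevant i A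
fibre-invariant⇒irrelevant {A = A} {i} invariant x y x≗y x∈A =
  subst (_∈ᶠ A) (≔-agree x y i x≗y) (invariant (lookup⁺ x i) (lookup⁺ y i) x
    (subst (_∈ᶠ A) (sym (≔-agree x x i (λ _ _ → refl))) x∈A))

-- The proportion of `A` with `xᵢ = l` is at least 1 - 1 / pᵢ, with denominators cleared.
Concentrated : ∀ {n} {p : Vec ℕ n} (A : Family p) (i : Fin n) → Fin (lookup p i) → Set
Concentrated {p = p} A i l = (lookup p i ∸ 1) * ∣ A ∣ ≤ lookup p i * ∣ slice A i l ∣

relevant⇒concentrated : ∀ {n r} {p : Vec ℕ n} → r ≤ n → (∀ i → 2 ≤ lookup p i) →
  {A B : Family p} → MaximalPair r A B → ∀ i → Relevant i A ⊎ Relevant i B →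
  ∃ λ l → Concentrated A i l × Concentrated B i l
relevant⇒concentrated {r = r} {p} r≤n p≥2 {A} {B} maximal@(cross , max) i relevant =
  [ (λ (l , a≤ , b≤) → l , subst (_ ≤_) (∣fibre∣ A i l) a≤ , subst (_ ≤_) (∣fibre∣ B i l) b≤)
  , constant
  ]′ (concentrated-or-constant m (p≥2 i) (∑-fibre A i) (∑-fibre B i) fibres≤)
  where
  open ≤-Reasoning
  m = lookup p i

  x₀ : S p
  x₀ = origin p≥2

  instance
    A≢0 : NonZero ∣ A ∣
    A≢0 = proj₁ (maximal⇒nonEmpty r≤n x₀ {A} {B} maximal)
    B≢0 : NonZero ∣ B ∣
    B≢0 = proj₂ (maximal⇒nonEmpty r≤n x₀ {A} {B} maximal)

  fibres≤ : ∀ l k → k ≢ l → ∣ fibre A i l ∣ * ∣ fibre B i k ∣ ≤ ∣ A ∣ * ∣ B ∣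
  fibres≤ l k k≢l = max _ _ (cross-fibre {A = A} {B} cross i (k≢l ∘ sym))

  constant : (∀ l → ∣ fibre A i l ∣ ≡ ∣ A ∣ × ∣ fibre B i l ∣ ≡ ∣ B ∣) →
             ∃ λ l → Concentrated A i l × Concentrated B i l
  constant const with 3 ≤? m
  -- Here `m = 2` and `m ∸ 1 = 1`, so fibres of size exactly `∣ A ∣` and `∣ B ∣` make every value
  -- popular; the one of `x₀` is an arbitrary choice.
  ... | no 3≰m = lookup⁺ x₀ i ,
      subst (_ ≤_) (∣fibre∣ A i _) (subst₂ _≤_ (p-1≡1 ∣ A ∣) (sym (proj₁ (const _))) ≤-refl) ,
      subst (_ ≤_) (∣fibre∣ B i _) (subst₂ _≤_ (p-1≡1 ∣ B ∣) (sym (proj₂ (const _))) ≤-refl)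
    where
    p-1≡1 : ∀ a → a ≡ (m ∸ 1) * a
    p-1≡1 a = trans (sym (*-identityˡ a)) (cong (λ m → (m ∸ 1) * a) (≤-antisym (p≥2 i) (≤-pred (≰⇒> 3≰m))))
  ... | yes 3≤m = contradiction relevant λ
      { (inj₁ relevantA) → relevantA (fibre-invariant⇒irrelevant {A = A} invariantA)
      ; (inj₂ relevantB) → relevantB (fibre-invariant⇒irrelevant {A = B} invariantB) }
    where
    invariantB : ∀ j k x → x ∈ᶠ fibre B i j → x ∈ᶠ fibre B i k
    invariantB j k x x∈ with avoid₂ 3≤m j k
    -- `fibre A i l` cross-intersects both fibres of `B`, hence their union `G`. As it has size
    -- `∣ A ∣` and `fibre B i k` has size `∣ B ∣`, maximality gives `∣ G ∣ ≤ ∣ fibre B i k ∣`, so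
    -- the other fibre adds nothing.
    ... | l , l≢j , l≢k = ⊆-rigid {F = fibre B i k} {G} (∪⁺ˡ (fibre B i k) (fibre B i j)) ∣G∣≤ x
                            (∪⁺ʳ (fibre B i k) (fibre B i j) x x∈)
      where
      G = fibre B i k ∪ fibre B i j

      cross′ : CrossIntersecting r (fibre A i l) G
      cross′ x y x∈ y∈ = [ cross-fibre {A = A} {B} cross i l≢k x y x∈ , cross-fibre {A = A} {B} cross i l≢j x y x∈ ]′
                           (∪⁻ (fibre B i k) (fibre B i j) y∈)

      ∣G∣≤ : ∣ G ∣ ≤ ∣ fibre B i k ∣
      ∣G∣≤ = *-cancelˡ-≤ ∣ A ∣ (subst₂ (λ a b → a * ∣ G ∣ ≤ ∣ A ∣ * b)
        (proj₁ (const l)) (sym (proj₂ (const k))) (max _ G cross′))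

    invariantA : ∀ j k x → x ∈ᶠ fibre A i j → x ∈ᶠ fibre A i k
    invariantA j k x x∈ with avoid₂ 3≤m j k
    ... | l , l≢j , l≢k = ⊆-rigid {F = fibre A i k} {G} (∪⁺ˡ (fibre A i k) (fibre A i j)) ∣G∣≤ x
                            (∪⁺ʳ (fibre A i k) (fibre A i j) x x∈)
      where
      G = fibre A i k ∪ fibre A i j

      cross′ : CrossIntersecting r G (fibre B i l)
      cross′ x y x∈ y∈ = [ (λ x∈ → cross-fibre {A = A} {B} cross i (l≢k ∘ sym) x y x∈ y∈)
                         , (λ x∈ → cross-fibre {A = A} {B} cross i (l≢j ∘ sym) x y x∈ y∈)
                         ]′ (∪⁻ (fibre A i k) (fibre A i j) x∈)

      ∣G∣≤ : ∣ G ∣ ≤ ∣ fibre A i k ∣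
      ∣G∣≤ = *-cancelʳ-≤ _ _ ∣ B ∣ (subst₂ (λ b a → ∣ G ∣ * b ≤ a * ∣ B ∣)
        (proj₂ (const l)) (sym (proj₁ (const k))) (max G _ cross′))

-- The weighted count

prod-one : ∀ n → prod {n} (λ _ → 1) ≡ 1
prod-one zero    = refl
prod-one (suc n) = trans (+-identityʳ _) (prod-one n)

prod-mono : ∀ {n} {f g : Fin n → ℕ} → (∀ i → f i ≤ g i) → prod f ≤ prod g
prod-mono {zero}  f≤g = ≤-refl
prod-mono {suc n} f≤g = *-mono-≤ (f≤g zero) (prod-mono (f≤g ∘ suc))

prod-≢0 : ∀ {n} {f : Fin n → ℕ} → (∀ i → NonZero (f i)) → NonZero (prod f)
prod-≢0 {zero}      f≢0 = _
prod-≢0 {suc n} {f} f≢0 = m*n≢0 (f zero) _ {{f≢0 zero}} {{prod-≢0 (f≢0 ∘ suc)}}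

prod-^ : ∀ {n} (f : Fin n → ℕ) k → prod f ^ k ≡ prod (λ i → f i ^ k)
prod-^ {zero}  f k = ^-zeroˡ k
prod-^ {suc n} f k = trans (^-distribʳ-* k (f zero) _) (cong (f zero ^ k *_) (prod-^ (f ∘ suc) k))

weight : ∀ {n} {p : Vec ℕ n} → (Fin n → ℕ) → S p → S p → ℕ
weight c x₀ x = prod (λ i → if does (lookup⁺ x i ≟ lookup⁺ x₀ i) then c i else 1)

-- The sum factorizes over the coordinates, each contributing `c i` once and 1 otherwise. For
-- `c i = b i * b i` the balance condition says (b - 1)(b - (pᵢ - 1)) = 0, which explains the
-- squares in the weight: both 1 and pᵢ - 1 are admissible values of `b i`.
∑S-weight : ∀ {n} (p : Vec ℕ n) (b c : Fin n → ℕ) (x₀ : S p) →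
            (∀ i → c i + (lookup p i ∸ 1) ≡ lookup p i * b i) →
            ∑S p (weight c x₀) ≡ ∣S p ∣ * prod b
∑S-weight p b c x₀ balanced = trans (∑S≡ p b c x₀ balanced) (cong (_* prod b) (sym (∣S∣-∑S p)))
  where
  ∑S≡ : ∀ {n} (p : Vec ℕ n) (b c : Fin n → ℕ) (x₀ : S p) →
        (∀ i → c i + (lookup p i ∸ 1) ≡ lookup p i * b i) →
        ∑S p (weight c x₀) ≡ ∑S p (λ _ → 1) * prod b
  ∑S≡ []            b c []       balanced = refl
  ∑S≡ (m@(suc m-1) ∷ p) b c (l ∷ x₀) balanced = begin
    ∑[ j < m ] ∑S p (λ x → v j * weight (c ∘ suc) x₀ x)
      ≡⟨ sum-cong-≗ (λ j → *-distribˡ-∑S p (v j) (weight (c ∘ suc) x₀)) ⟨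
    ∑[ j < m ] (v j * ∑S p (weight (c ∘ suc) x₀))
      ≡⟨ *-distribʳ-sum _ v ⟨
    ∑ v * ∑S p (weight (c ∘ suc) x₀)
      ≡⟨ cong₂ _*_ ∑v (∑S≡ p (b ∘ suc) (c ∘ suc) x₀ (balanced ∘ suc)) ⟩
    m * b zero * (∑S p (λ _ → 1) * prod (b ∘ suc))
      ≡⟨ regroup m (b zero) (∑S p (λ _ → 1)) (prod (b ∘ suc)) ⟩
    m * ∑S p (λ _ → 1) * (b zero * prod (b ∘ suc))
      ≡⟨ cong (_* prod b) (∑-const m (∑S p (λ _ → 1))) ⟨
    ∑[ j < m ] ∑S p (λ _ → 1) * prod b ∎
    where
    open ≡-Reasoning
    regroup : ∀ m b s q → m * b * (s * q) ≡ m * s * (b * q)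
    regroup = solve-∀

    v : Fin m → ℕ
    v j = if does (j ≟ l) then c zero else 1

    v-on : v l ≡ c zero
    v-on with l ≟ l
    ... | yes _  = refl
    ... | no l≢l = contradiction refl l≢l

    v-off : ∀ k → k ≢ l → v k ≡ 1
    v-off k k≢l with k ≟ l
    ... | yes k≡l = contradiction k≡l k≢l
    ... | no _    = refl

    ∑v : ∑ v ≡ m * b zero
    ∑v = trans (∑-constʳ v l v-off) (trans (cong₂ _+_ v-on (*-identityʳ m-1)) (balanced zero))

-- Exchange of the two products: `c i` occurs once for every list entry that agrees with `x₀` at
-- `i`.
product-weight : ∀ {n} {p : Vec ℕ n} (c : Fin n → ℕ) (x₀ : S p) xs →
  product (map (weight c x₀) xs) ≡ prod (λ i → c i ^ length (filterᵇ (λ x → does (lookup⁺ x i ≟ lookup⁺ x₀ i)) xs))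
product-weight {n}     c x₀ []       = sym (prod-one n)
product-weight {n} {p} c x₀ (x ∷ xs) = trans (cong (weight c x₀ x *_) (product-weight c x₀ xs))
  (trans (sym (prod-distrib-* {n} _ _)) (prod-cong step))
  where
  hits : List (S p) → Fin n → ℕ
  hits xs i = length (filterᵇ (λ x → does (lookup⁺ x i ≟ lookup⁺ x₀ i)) xs)

  step : ∀ i → (if does (lookup⁺ x i ≟ lookup⁺ x₀ i) then c i else 1) * c i ^ hits xs i ≡ c i ^ hits (x ∷ xs) i
  step i with does (lookup⁺ x i ≟ lookup⁺ x₀ i)
  ... | true  = refl
  ... | false = *-identityˡ _

module _ {X : Set} (P : X → Bool) where

  length-filterᵇ-∧ : ∀ Q xs → length (filterᵇ Q (filterᵇ P xs)) ≡ length (filterᵇ (λ x → P x ∧ Q x) xs)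
  length-filterᵇ-∧ Q []       = refl
  length-filterᵇ-∧ Q (x ∷ xs) with P x
  ... | false = length-filterᵇ-∧ Q xs
  ... | true  with Q x
  ... | true  = cong suc (length-filterᵇ-∧ Q xs)
  ... | false = length-filterᵇ-∧ Q xs

  sum-filterᵇ-≤ : ∀ (f : X → ℕ) xs → sum (map f (filterᵇ P xs)) ≤ sum (map f xs)
  sum-filterᵇ-≤ f []       = z≤n
  sum-filterᵇ-≤ f (x ∷ xs) with P x
  ... | true  = +-monoʳ-≤ (f x) (sum-filterᵇ-≤ f xs)
  ... | false = m≤n⇒m≤o+n (f x) (sum-filterᵇ-≤ f xs)

-- AM-GM for the weights of the members of `A`, whose sum is then enlarged to all of `S p`.
weighted-bound : ∀ {n} {p : Vec ℕ n} (A : Family p) (b c : Fin n → ℕ) (x₀ : S p) →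
  (∀ i → c i + (lookup p i ∸ 1) ≡ lookup p i * b i) →
  ∣ A ∣ ^ ∣ A ∣ * prod (λ i → c i ^ ∣ slice A i (lookup⁺ x₀ i) ∣) ≤ (∣S p ∣ * prod b) ^ ∣ A ∣
weighted-bound {p = p} A b c x₀ balanced = begin
  ∣ A ∣ ^ ∣ A ∣ * prod (λ i → c i ^ ∣ slice A i (lookup⁺ x₀ i) ∣)
    ≡⟨ cong₂ (λ l q → l ^ l * q) (sym (length-map (weight c x₀) xs))
         (sym (trans (product-weight c x₀ xs) (prod-cong (λ i → cong (c i ^_) (length-filterᵇ-∧ A _ (vectors p)))))) ⟩
  length ws ^ length ws * product ws
    ≤⟨ am-gm ws ⟩
  sum ws ^ length ws
    ≡⟨ cong (sum ws ^_) (length-map (weight c x₀) xs) ⟩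
  sum ws ^ ∣ A ∣
    ≤⟨ ^-monoˡ-≤ ∣ A ∣ (sum-filterᵇ-≤ A (weight c x₀) (vectors p)) ⟩
  sum (map (weight c x₀) (vectors p)) ^ ∣ A ∣
    ≡⟨ cong (_^ ∣ A ∣) (trans (sum-vectors p (weight c x₀)) (∑S-weight p b c x₀ balanced)) ⟩
  (∣S p ∣ * prod b) ^ ∣ A ∣ ∎
  where
  open ≤-Reasoning
  xs = filterᵇ A (vectors p)
  ws = map (weight c x₀) xs

-- The exponents 1 - 2 / pᵢ are cleared by a common multiple `M` of the sizes. Multiplying by
-- `prod b ^ M` turns (pᵢ - 2) kᵢ into 2 (pᵢ - 1) kᵢ, a power of the squares in the weight; after
-- raising to the power `N`, concentration bounds (pᵢ - 1) kᵢ N by dᵢ M, and `weighted-bound`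
-- applies.
family-bound : ∀ {n} {p : Vec ℕ n} → (∀ i → 2 ≤ lookup p i) →
  (A : Family p) .{{_ : NonZero ∣ A ∣}} (x₀ : S p) (b : Fin n → ℕ) →
  (∀ i → b i ≡ 1 ⊎ (b i ≡ lookup p i ∸ 1 × Concentrated A i (lookup⁺ x₀ i))) →
  ∀ M (k : Fin n → ℕ) → (∀ i → lookup p i * k i ≡ M) →
  ∣ A ∣ ^ M * prod (λ i → b i ^ ((lookup p i ∸ 2) * k i)) ≤ ∣S p ∣ ^ M
family-bound {n} {p} p≥2 A x₀ b concentrated M k pk≡M =
  *-cancelʳ-≤ _ _ (prod b ^ M) {{m^n≢0 (prod b) M {{prod-≢0 b≢0}}}} (^-cancelˡ-≤ N (begin
    (N ^ M * prod (λ i → b i ^ ((lookup p i ∸ 2) * k i)) * prod b ^ M) ^ N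
      ≡⟨ cong (_^ N) (trans (*-assoc (N ^ M) _ _) (cong (N ^ M *_) powers)) ⟩
    (N ^ M * prod (λ i → (b i * b i) ^ ((lookup p i ∸ 1) * k i))) ^ N
      ≡⟨ ^-distribʳ-* N (N ^ M) _ ⟩
    (N ^ M) ^ N * prod (λ i → (b i * b i) ^ ((lookup p i ∸ 1) * k i)) ^ N
      ≤⟨ *-mono-≤ (≤-reflexive (^-comm N M N)) (≤-trans (≤-reflexive (prod-^ {n} _ N))
           (≤-trans (prod-mono exponent≤) (≤-reflexive (sym (prod-^ {n} _ M))))) ⟩
    (N ^ N) ^ M * prod (λ i → (b i * b i) ^ d i) ^ M
      ≡⟨ ^-distribʳ-* M (N ^ N) _ ⟨
    (N ^ N * prod (λ i → (b i * b i) ^ d i)) ^ M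
      ≤⟨ ^-monoˡ-≤ M (weighted-bound A b (λ i → b i * b i) x₀ balanced) ⟩
    ((∣S p ∣ * prod b) ^ N) ^ M
      ≡⟨ ^-comm (∣S p ∣ * prod b) N M ⟩
    ((∣S p ∣ * prod b) ^ M) ^ N
      ≡⟨ cong (_^ N) (^-distribʳ-* M ∣S p ∣ (prod b)) ⟩
    (∣S p ∣ ^ M * prod b ^ M) ^ N ∎))
  where
  open ≤-Reasoning
  N = ∣ A ∣

  d : Fin n → ℕ
  d i = ∣ slice A i (lookup⁺ x₀ i) ∣

  ^-comm : ∀ a m n → (a ^ m) ^ n ≡ (a ^ n) ^ m
  ^-comm a m n = trans (^-*-assoc a m n) (trans (cong (a ^_) (*-comm m n)) (sym (^-*-assoc a n m)))

  b≢0 : ∀ i → NonZero (b i)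
  b≢0 i with concentrated i
  ... | inj₁ b≡1       = subst NonZero (sym b≡1) _
  ... | inj₂ (b≡ , _)  = subst NonZero (sym b≡) (>-nonZero (∸-monoˡ-≤ 1 (p≥2 i)))

  balanced : ∀ i → b i * b i + (lookup p i ∸ 1) ≡ lookup p i * b i
  balanced i with concentrated i
  ... | inj₁ b≡1 = subst (λ b → b * b + (lookup p i ∸ 1) ≡ lookup p i * b) (sym b≡1) (one (lookup p i) (p≥2 i))
    where
    one : ∀ m → 2 ≤ m → 1 * 1 + (m ∸ 1) ≡ m * 1
    one (suc m) _ = cong suc (sym (*-identityʳ m))
  ... | inj₂ (b≡ , _) = subst (λ b → b * b + (lookup p i ∸ 1) ≡ lookup p i * b) (sym b≡) (pred (lookup p i) (p≥2 i))
    where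
    pred : ∀ m → 2 ≤ m → (m ∸ 1) * (m ∸ 1) + (m ∸ 1) ≡ m * (m ∸ 1)
    pred (suc m) _ = +-comm (m * m) m

  powers : prod (λ i → b i ^ ((lookup p i ∸ 2) * k i)) * prod b ^ M ≡
           prod (λ i → (b i * b i) ^ ((lookup p i ∸ 1) * k i))
  powers = trans (cong (prod {n} _ *_) (prod-^ b M)) (trans (sym (prod-distrib-* {n} _ _)) (prod-cong pointwise))
    where
    2[p-1]k : ∀ m → 2 ≤ m → ∀ k → (m ∸ 2) * k + m * k ≡ 2 * ((m ∸ 1) * k)
    2[p-1]k (suc (suc m)) (s≤s (s≤s _)) k = identity m k
      where
      identity : ∀ m k → m * k + suc (suc m) * k ≡ 2 * (suc m * k)
      identity = solve-∀

    pointwise : ∀ i → b i ^ ((lookup p i ∸ 2) * k i) * b i ^ M ≡ (b i * b i) ^ ((lookup p i ∸ 1) * k i)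
    pointwise i = begin-equality
      b i ^ ((lookup p i ∸ 2) * k i) * b i ^ M
        ≡⟨ ^-distribˡ-+-* (b i) ((lookup p i ∸ 2) * k i) M ⟨
      b i ^ ((lookup p i ∸ 2) * k i + M)
        ≡⟨ cong (λ z → b i ^ ((lookup p i ∸ 2) * k i + z)) (pk≡M i) ⟨
      b i ^ ((lookup p i ∸ 2) * k i + lookup p i * k i)
        ≡⟨ cong (b i ^_) (2[p-1]k (lookup p i) (p≥2 i) (k i)) ⟩
      b i ^ (2 * ((lookup p i ∸ 1) * k i))
        ≡⟨ ^-*-assoc (b i) 2 ((lookup p i ∸ 1) * k i) ⟨
      (b i ^ 2) ^ ((lookup p i ∸ 1) * k i)
        ≡⟨ cong (λ z → (b i * z) ^ ((lookup p i ∸ 1) * k i)) (*-identityʳ (b i)) ⟩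
      (b i * b i) ^ ((lookup p i ∸ 1) * k i) ∎

  exponent≤ : ∀ i → ((b i * b i) ^ ((lookup p i ∸ 1) * k i)) ^ N ≤ ((b i * b i) ^ d i) ^ M
  exponent≤ i with concentrated i
  ... | inj₁ b≡1 = ≤-reflexive (trans (one ((lookup p i ∸ 1) * k i) N) (sym (one (d i) M)))
    where
    one : ∀ e f → ((b i * b i) ^ e) ^ f ≡ 1
    one e f = trans (cong (λ z → ((z * z) ^ e) ^ f) b≡1) (trans (cong (_^ f) (^-zeroˡ e)) (^-zeroˡ f))
  ... | inj₂ (_ , [p-1]N≤pd) = begin
    ((b i * b i) ^ ((lookup p i ∸ 1) * k i)) ^ N
      ≡⟨ ^-*-assoc (b i * b i) ((lookup p i ∸ 1) * k i) N ⟩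
    (b i * b i) ^ ((lookup p i ∸ 1) * k i * N)
      ≤⟨ ^-monoʳ-≤ (b i * b i) {{m*n≢0 (b i) (b i) {{b≢0 i}} {{b≢0 i}}}} (begin
           (lookup p i ∸ 1) * k i * N  ≡⟨ left (lookup p i ∸ 1) (k i) N ⟩
           (lookup p i ∸ 1) * N * k i  ≤⟨ *-monoˡ-≤ (k i) [p-1]N≤pd ⟩
           lookup p i * d i * k i      ≡⟨ right (lookup p i) (d i) (k i) ⟩
           d i * (lookup p i * k i)    ≡⟨ cong (d i *_) (pk≡M i) ⟩
           d i * M                     ∎) ⟩
    (b i * b i) ^ (d i * M)
      ≡⟨ ^-*-assoc (b i * b i) (d i) M ⟨
    ((b i * b i) ^ d i) ^ M ∎
    where
    left : ∀ m k n → m * k * n ≡ m * n * k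
    left = solve-∀
    right : ∀ m d k → m * d * k ≡ d * (m * k)
    right = solve-∀

-- Bounds for the cuts

ι : ℕ → ℚ
ι n = ℤ.+ n ℚ./ 1

toℚᵘ-ι : ∀ n → toℚᵘ (ι n) ℚᵘ.≃ mkℚᵘ (ℤ.+ n) 0
toℚᵘ-ι n = ℚ.toℚᵘ-fromℚᵘ (mkℚᵘ (ℤ.+ n) 0)

ι-mono-≤ : ∀ {m n} → m ≤ n → ι m ℚ.≤ ι n
ι-mono-≤ {m} {n} m≤n = ℚ.toℚᵘ-cancel-≤ (ℚᵘ.≤-respˡ-≃ (ℚᵘ.≃-sym (toℚᵘ-ι m)) (ℚᵘ.≤-respʳ-≃ (ℚᵘ.≃-sym (toℚᵘ-ι n))
  (*≤* (ℤ.*-monoʳ-≤-nonNeg (ℤ.+ 1) (ℤ.+≤+ m≤n)))))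

ι-* : ∀ m n → ι (m * n) ≡ ι m ℚ.* ι n
ι-* m n = ℚ.toℚᵘ-injective (begin
  toℚᵘ (ι (m * n))                  ≈⟨ toℚᵘ-ι (m * n) ⟩
  mkℚᵘ (ℤ.+ (m * n)) 0                ≡⟨ cong (λ z → mkℚᵘ z 0) (ℤ.pos-* m n) ⟩
  mkℚᵘ (ℤ.+ m) 0 ℚᵘ.* mkℚᵘ (ℤ.+ n) 0    ≈⟨ ℚᵘ.*-cong (toℚᵘ-ι m) (toℚᵘ-ι n) ⟨
  toℚᵘ (ι m) ℚᵘ.* toℚᵘ (ι n)        ≈⟨ ℚ.toℚᵘ-homo-* (ι m) (ι n) ⟨
  toℚᵘ (ι m ℚ.* ι n)                ∎)
  where open ℚᵘ.≃-Reasoning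

ι-^ : ∀ m k → ι (m ^ k) ≡ ι m ^ℚ k
ι-^ m zero    = refl
ι-^ m (suc k) = trans (ι-* m (m ^ k)) (cong (ι m ℚ.*_) (ι-^ m k))

0≤ι : ∀ n → 0ℚ ℚ.≤ ι n
0≤ι n = ι-mono-≤ {0} {n} z≤n

0<ι : ∀ n .{{_ : NonZero n}} → 0ℚ ℚ.< ι n
0<ι n = ℚ.positive⁻¹ (ι n) {{ℚ.normalize-pos n 1}}

*ℚ-mono-≤ : ∀ {a b c d} → 0ℚ ℚ.≤ a → 0ℚ ℚ.≤ d → a ℚ.≤ c → b ℚ.≤ d → a ℚ.* b ℚ.≤ c ℚ.* d
*ℚ-mono-≤ {a} {b} {c} {d} 0≤a 0≤d a≤c b≤d = ℚ.≤-trans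
  (ℚ.*-monoˡ-≤-nonNeg a {{nonNegative 0≤a}} b≤d)
  (ℚ.*-monoʳ-≤-nonNeg d {{nonNegative 0≤d}} a≤c)

0<* : ∀ {a b} → 0ℚ ℚ.< a → 0ℚ ℚ.< b → 0ℚ ℚ.< a ℚ.* b
0<* {a} {b} 0<a 0<b = subst (ℚ._< a ℚ.* b) (ℚ.*-zeroʳ a) (ℚ.*-monoʳ-<-pos a {{positive 0<a}} 0<b)

0<^ℚ : ∀ k {s} → 0ℚ ℚ.< s → 0ℚ ℚ.< s ^ℚ k
0<^ℚ zero    0<s = ℚ.positive⁻¹ 1ℚ
0<^ℚ (suc k) 0<s = 0<* 0<s (0<^ℚ k 0<s)

^ℚ-mono-≤ : ∀ k {s t} → 0ℚ ℚ.< s → s ℚ.≤ t → s ^ℚ k ℚ.≤ t ^ℚ k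
^ℚ-mono-≤ zero    0<s s≤t = ℚ.≤-refl
^ℚ-mono-≤ (suc k) 0<s s≤t =
  *ℚ-mono-≤ (ℚ.<⇒≤ 0<s) (ℚ.<⇒≤ (0<^ℚ k (ℚ.<-≤-trans 0<s s≤t))) s≤t (^ℚ-mono-≤ k 0<s s≤t)

^ℚ-mono-< : ∀ k .{{_ : NonZero k}} {s t} → 0ℚ ℚ.< s → s ℚ.< t → s ^ℚ k ℚ.< t ^ℚ k
^ℚ-mono-< (suc k) {s} {t} 0<s s<t = ℚ.<-≤-trans
  (ℚ.*-monoˡ-<-pos (s ^ℚ k) {{positive (0<^ℚ k 0<s)}} s<t)
  (ℚ.*-monoˡ-≤-nonNeg t {{nonNegative (ℚ.<⇒≤ (ℚ.<-trans 0<s s<t))}} (^ℚ-mono-≤ k 0<s (ℚ.<⇒≤ s<t)))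

^ℚ-cancel-≤ : ∀ k .{{_ : NonZero k}} {s t} → 0ℚ ℚ.< t → s ^ℚ k ℚ.≤ t ^ℚ k → s ℚ.≤ t
^ℚ-cancel-≤ k 0<t s^k≤t^k = ℚ.≮⇒≥ λ t<s → ℚ.<-irrefl refl (ℚ.<-≤-trans (^ℚ-mono-< k 0<t t<s) s^k≤t^k)

^ℚ-comm : ∀ s m n → (s ^ℚ m) ^ℚ n ≡ (s ^ℚ n) ^ℚ m
^ℚ-comm s m n = trans (^ℚ-*-assoc s m n) (trans (cong (s ^ℚ_) (*-comm m n)) (sym (^ℚ-*-assoc s n m)))

-- The cut provides some `u` beyond `s` whose `k`-th power is still below `c`.
root-lower : ∀ k c .{{_ : NonZero k}} .{{_ : NonZero c}} {s} → 0ℚ ℚ.< s → ℝ⁺.L (root k c) s → s ^ℚ k ℚ.≤ ι c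
root-lower k c 0<s (u , s<u , _ , u^k<c) = ℚ.≤-trans (^ℚ-mono-≤ k 0<s (ℚ.<⇒≤ s<u)) (ℚ.<⇒≤ u^k<c)

-- The power is defined through the reduced fraction e / d, whereas j / (m + 1) need not be reduced.
-- Both sides are raised to the power `d`, where cross-multiplication matches the exponents.
^ᴿ-lower : ∀ b .{{_ : NonZero b}} q j m → toℚᵘ q ℚᵘ.≃ mkℚᵘ (ℤ.+ j) m →
           ∀ {s} → 0ℚ ℚ.< s → ℝ⁺.L (b ^ᴿ q) s → s ^ℚ suc m ℚ.≤ ι (b ^ j)
^ᴿ-lower b (mkℚ (ℤ.+ e) d-1 _) j m (*≡* em≡jd) {s} 0<s Ls =
  ^ℚ-cancel-≤ d (0<ι (b ^ j) {{m^n≢0 b j}}) (begin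
    (s ^ℚ suc m) ^ℚ d     ≡⟨ ^ℚ-comm s (suc m) d ⟩
    (s ^ℚ d) ^ℚ suc m     ≤⟨ ^ℚ-mono-≤ (suc m) (0<^ℚ d 0<s) (root-lower d (b ^ e) {{_}} {{m^n≢0 b e}} 0<s Ls) ⟩
    ι (b ^ e) ^ℚ suc m    ≡⟨ ι-^ (b ^ e) (suc m) ⟨
    ι ((b ^ e) ^ suc m)   ≡⟨ cong ι (trans (^-*-assoc b e (suc m)) (trans (cong (b ^_) e*m≡j*d) (sym (^-*-assoc b j d)))) ⟩
    ι ((b ^ j) ^ d)       ≡⟨ ι-^ (b ^ j) d ⟩
    ι (b ^ j) ^ℚ d        ∎)
  where
  open ℚ.≤-Reasoning
  d = suc d-1
  e*m≡j*d : e * suc m ≡ j * d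
  e*m≡j*d = ℤ.+-injective (trans (ℤ.pos-* e (suc m)) (trans em≡jd (sym (ℤ.pos-* j d))))
-- A negative exponent cannot equal j / (m + 1); splitting `j` lets the cross-multiplied equation
-- compute to an absurdity.
^ᴿ-lower b (mkℚ -[1+ e ] d-1 _) zero    m (*≡* ()) 0<s Ls
^ᴿ-lower b (mkℚ -[1+ e ] d-1 _) (suc j) m (*≡* ()) 0<s Ls

-- `mkℚᵘ` stores the denominator minus one, so for `m = suc (suc j)` the right-hand side is the
-- possibly unreduced fraction (m - 2) / m.
1-2/m : ∀ j → toℚᵘ (1ℚ ℚ.- ℤ.+ 2 ℚ./ suc (suc j)) ℚᵘ.≃ mkℚᵘ (ℤ.+ j) (suc j)
1-2/m j = begin
  toℚᵘ (1ℚ ℚ.- ℤ.+ 2 ℚ./ m)                ≈⟨ ℚ.toℚᵘ-homo-+ 1ℚ (ℚ.- (ℤ.+ 2 ℚ./ m)) ⟩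
  toℚᵘ 1ℚ ℚᵘ.+ toℚᵘ (ℚ.- (ℤ.+ 2 ℚ./ m))    ≈⟨ ℚᵘ.+-congʳ (toℚᵘ 1ℚ) (ℚ.toℚᵘ-homo‿- (ℤ.+ 2 ℚ./ m)) ⟩
  toℚᵘ 1ℚ ℚᵘ.- toℚᵘ (ℤ.+ 2 ℚ./ m)          ≈⟨ ℚᵘ.+-congʳ (toℚᵘ 1ℚ) (ℚᵘ.-‿cong (ℚ.toℚᵘ-fromℚᵘ (mkℚᵘ (ℤ.+ 2) (suc j)))) ⟩
  toℚᵘ 1ℚ ℚᵘ.- mkℚᵘ (ℤ.+ 2) (suc j)        ≈⟨ *≡* (cong₂ ℤ._*_ numerator (cong ℤ.+_ (sym (+-identityʳ m)))) ⟩
  mkℚᵘ (ℤ.+ j) (suc j)                     ∎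
  where
  open ℚᵘ.≃-Reasoning
  m = suc (suc j)
  numerator : (ℤ.+ 1) ℤ.* (ℤ.+ m) ℤ.+ -[1+ 1 ] ℤ.* (ℤ.+ 1) ≡ ℤ.+ j
  numerator = cong (λ z → (ℤ.+ z) ℤ.+ -[1+ 1 ]) (+-identityʳ m)

factor-lower : ∀ m 2≤m {s} → 0ℚ ℚ.< s → ℝ⁺.L (factor m 2≤m) s → s ^ℚ m ℚ.≤ ι ((m ∸ 1) ^ (m ∸ 2))
factor-lower (suc (suc j)) (s≤s (s≤s _)) = ^ᴿ-lower (suc j) (1ℚ ℚ.- ℤ.+ 2 ℚ./ suc (suc j)) j (suc j) (1-2/m j)

-- A lower bound of a product lies below some `a ℚ.* b` with positive lower bounds `a`, `b` of the
-- factors, so the `M`-th powers multiply.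
∏-lower : ∀ {n} (T : Subset n) (f : Fin n → ℝ⁺) (g : Fin n → ℕ) M →
          (∀ i {s} → 0ℚ ℚ.< s → ℝ⁺.L (f i) s → s ^ℚ M ℚ.≤ ι (g i)) →
          ∀ {s} → 0ℚ ℚ.< s → ℝ⁺.L (∏ T f) s → s ^ℚ M ℚ.≤ ι (prod (λ i → if lookup T i then g i else 1))
∏-lower []            f g M f≤g {s} 0<s s<1 = begin
  s ^ℚ M     ≤⟨ ^ℚ-mono-≤ M 0<s (ℚ.<⇒≤ s<1) ⟩
  ι 1 ^ℚ M   ≡⟨ ι-^ 1 M ⟨
  ι (1 ^ M)  ≡⟨ cong ι (^-zeroˡ M) ⟩
  ι 1        ∎
  where open ℚ.≤-Reasoning
∏-lower (inside ∷ T)  f g M f≤g {s} 0<s (a , b , (0<a , La) , (0<b , Lb) , s<ab) = begin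
  s ^ℚ M               ≤⟨ ^ℚ-mono-≤ M 0<s (ℚ.<⇒≤ s<ab) ⟩
  (a ℚ.* b) ^ℚ M       ≡⟨ ^ℚ-distrib-* a b M ⟩
  a ^ℚ M ℚ.* b ^ℚ M    ≤⟨ *ℚ-mono-≤ (ℚ.<⇒≤ (0<^ℚ M 0<a)) (0≤ι G) (f≤g zero 0<a La)
                            (∏-lower T (f ∘ suc) (g ∘ suc) M (f≤g ∘ suc) 0<b Lb) ⟩
  ι (g zero) ℚ.* ι G   ≡⟨ ι-* (g zero) G ⟨
  ι (g zero * G)       ∎
  where
  open ℚ.≤-Reasoning
  G = prod (λ i → if lookup T i then g (suc i) else 1)
∏-lower (outside ∷ T) f g M f≤g {s} 0<s Ls =
  subst (λ z → s ^ℚ M ℚ.≤ ι z) (sym (*-identityˡ (prod (λ i → if lookup T i then g (suc i) else 1))))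
    (∏-lower T (f ∘ suc) (g ∘ suc) M (f≤g ∘ suc) 0<s Ls)

-- If the quotient were below `N`, unpacking its cut would give `K < a`, a lower bound `c` of `P`
-- with `1 < c * b`, and `a * b < N`. Then a < a b c < N c ≤ K < a, where `N c ≤ K` is checked on
-- `M`-th powers.
≤-÷ᴿ : ∀ N K M P G .{{_ : NonZero K}} .{{_ : NonZero M}} →
       (∀ {s} → 0ℚ ℚ.< s → ℝ⁺.L P s → s ^ℚ M ℚ.≤ ι G) → N ^ M * G ≤ K ^ M →
       fromℕ N ≤ᴿ value (fromℕ⁺ K ÷ᴿ P)
≤-÷ᴿ N K M P G P≤G N^M*G≤K^M (q , (a , b , K<a , (c , 0<c , Lc , 1<cb) , ab<q) , q<N) =
  ℚ.<-irrefl refl (begin-strict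
    a                  ≡⟨ ℚ.*-identityʳ a ⟨
    a ℚ.* 1ℚ           <⟨ ℚ.*-monoʳ-<-pos a {{positive 0<a}} 1<cb ⟩
    a ℚ.* (c ℚ.* b)    ≡⟨ rearrange a b c ⟩
    a ℚ.* b ℚ.* c      <⟨ ℚ.*-monoˡ-<-pos c {{positive 0<c}} (ℚ.<-trans ab<q q<N) ⟩
    ι N ℚ.* c          ≤⟨ Nc≤K ⟩
    ι K                <⟨ K<a ⟩
    a                  ∎)
  where
  open ℚ.≤-Reasoning
  0<a : 0ℚ ℚ.< a
  0<a = ℚ.<-trans (0<ι K) K<a

  rearrange : ∀ a b c → a ℚ.* (c ℚ.* b) ≡ a ℚ.* b ℚ.* c
  rearrange = solve 3 (λ a b c → a :* (c :* b) := a :* b :* c) refl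
    where open ℚ.+-*-Solver

  Nc≤K : ι N ℚ.* c ℚ.≤ ι K
  Nc≤K = ^ℚ-cancel-≤ M (0<ι K) (begin
    (ι N ℚ.* c) ^ℚ M          ≡⟨ ^ℚ-distrib-* (ι N) c M ⟩
    ι N ^ℚ M ℚ.* c ^ℚ M       ≡⟨ cong (ℚ._* c ^ℚ M) (ι-^ N M) ⟨
    ι (N ^ M) ℚ.* c ^ℚ M      ≤⟨ ℚ.*-monoˡ-≤-nonNeg (ι (N ^ M)) {{nonNegative (0≤ι (N ^ M))}} (P≤G 0<c Lc) ⟩
    ι (N ^ M) ℚ.* ι G         ≡⟨ ι-* (N ^ M) G ⟨
    ι (N ^ M * G)             ≤⟨ ι-mono-≤ {N ^ M * G} {K ^ M} N^M*G≤K^M ⟩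
    ι (K ^ M)                 ≡⟨ ι-^ K M ⟩
    ι K ^ℚ M                  ∎)

-- From popular values to the real bound

lookup⁺-lookup⁻ : ∀ {n} (p : Vec ℕ n) (f : ∀ i → Fin (lookup p i)) i → lookup⁺ {P = Fin} (lookup⁻ {xs = p} f) i ≡ f i
lookup⁺-lookup⁻ (_ ∷ _) f zero    = refl
lookup⁺-lookup⁻ (_ ∷ p) f (suc i) = lookup⁺-lookup⁻ p (f ∘ suc) i

-- The product of all sizes serves as the common denominator of the exponents 1 - 2 / pᵢ.
divides-prod : ∀ {n} (f : Fin n → ℕ) i → ∃ λ k → f i * k ≡ prod f
divides-prod f zero    = prod (f ∘ suc) , refl
divides-prod f (suc i) with divides-prod (f ∘ suc) i
... | k , fk≡ = f zero * k , trans (swap (f (suc i)) (f zero) k) (cong (f zero *_) fk≡)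
  where
  swap : ∀ a b k → a * (b * k) ≡ b * (a * k)
  swap = solve-∀

concentrated⇒bound : ∀ {n} {p : Vec ℕ n} (p≥2 : ∀ i → 2 ≤ lookup p i)
  (A : Family p) .{{_ : NonZero ∣ A ∣}} (T : Subset n) (x₀ : S p) →
  (∀ i → i ∈ T → Concentrated A i (lookup⁺ x₀ i)) →
  fromℕ ∣ A ∣ ≤ᴿ value (fromℕ⁺ ∣S p ∣ {{∣S∣-nonZero p p≥2}} ÷ᴿ ∏[ i ∈ T ] factor (lookup p i) (p≥2 i))
concentrated⇒bound {n} {p} p≥2 A T x₀ concentrated =
  ≤-÷ᴿ ∣ A ∣ ∣S p ∣ M (∏[ i ∈ T ] factor (lookup p i) (p≥2 i)) (prod (λ i → if lookup T i then g i else 1))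
    {{∣S∣-nonZero p p≥2}} {{prod-≢0 p≢0}} (∏-lower T _ g M power≤g)
    (subst (λ G → ∣ A ∣ ^ M * G ≤ ∣S p ∣ ^ M) (prod-cong b^e≡)
      (family-bound p≥2 A x₀ b b-concentrated M k (λ i → proj₂ (divides-prod (lookup p) i))))
  where
  p≢0 : ∀ i → NonZero (lookup p i)
  p≢0 i = >-nonZero (≤-trans (s≤s z≤n) (p≥2 i))

  M : ℕ
  M = prod (lookup p)

  k b e g : Fin n → ℕ
  k i = proj₁ (divides-prod (lookup p) i)
  -- Off `T` the base is 1, so those coordinates leave both the weight and the bound unchanged.
  b i = if lookup T i then lookup p i ∸ 1 else 1
  e i = (lookup p i ∸ 2) * k i
  g i = (lookup p i ∸ 1) ^ e i

  b-concentrated : ∀ i → b i ≡ 1 ⊎ (b i ≡ lookup p i ∸ 1 × Concentrated A i (lookup⁺ x₀ i))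
  b-concentrated i with lookup T i in eq
  ... | false = inj₁ refl
  ... | true  = inj₂ (refl , concentrated i (lookup⇒[]= i T eq))

  b^e≡ : ∀ i → b i ^ e i ≡ (if lookup T i then g i else 1)
  b^e≡ i with lookup T i
  ... | true  = refl
  ... | false = ^-zeroˡ (e i)

  power≤g : ∀ i {s} → 0ℚ ℚ.< s → ℝ⁺.L (factor (lookup p i) (p≥2 i)) s → s ^ℚ M ℚ.≤ ι (g i)
  power≤g i {s} 0<s Ls = begin
    s ^ℚ M                                                ≡⟨ cong (s ^ℚ_) (proj₂ (divides-prod (lookup p) i)) ⟨
    s ^ℚ (lookup p i * k i)                               ≡⟨ ^ℚ-*-assoc s (lookup p i) (k i) ⟨
    (s ^ℚ lookup p i) ^ℚ k i                              ≤⟨ ^ℚ-mono-≤ (k i) (0<^ℚ (lookup p i) 0<s)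
                                                               (factor-lower (lookup p i) (p≥2 i) 0<s Ls) ⟩
    ι ((lookup p i ∸ 1) ^ (lookup p i ∸ 2)) ^ℚ k i        ≡⟨ ι-^ ((lookup p i ∸ 1) ^ (lookup p i ∸ 2)) (k i) ⟨
    ι (((lookup p i ∸ 1) ^ (lookup p i ∸ 2)) ^ k i)       ≡⟨ cong ι (^-*-assoc (lookup p i ∸ 1) (lookup p i ∸ 2) (k i)) ⟩
    ι (g i)                                               ∎
    where open ℚ.≤-Reasoning

theorem5 : (n r : ℕ) → 1 ≤ r → r ≤ n →
    (p : Vec ℕ n) (p≥2 : ∀ i → 2 ≤ lookup p i) →
    (A B : Family p) → MaximalPair r A B →
    (T : Subset n) → (∀ i → (i ∈ T) ⇔ (Relevant i A ⊎ Relevant i B)) →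
    (fromℕ ∣ A ∣ ≤ᴿ value (fromℕ⁺ ∣S p ∣ {{∣S∣-nonZero p p≥2}} ÷ᴿ ∏[ i ∈ T ] factor (lookup p i) (p≥2 i)))
    ×
    (fromℕ ∣ B ∣ ≤ᴿ value (fromℕ⁺ ∣S p ∣ {{∣S∣-nonZero p p≥2}} ÷ᴿ ∏[ i ∈ T ] factor (lookup p i) (p≥2 i)))
theorem5 n r _ r≤n p p≥2 A B maximal T relevant =
  (concentrated⇒bound p≥2 A {{proj₁ nonEmpty}} T popular (λ i i∈T → proj₁ (concentrated i i∈T))) ,
  (concentrated⇒bound p≥2 B {{proj₂ nonEmpty}} T popular (λ i i∈T → proj₂ (concentrated i i∈T)))
  where
  nonEmpty : NonZero ∣ A ∣ × NonZero ∣ B ∣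
  nonEmpty = maximal⇒nonEmpty r≤n (origin p≥2) {A} {B} maximal

  popularValue : ∀ i → ∃ λ l → i ∈ T → Concentrated A i l × Concentrated B i l
  popularValue i with i ∈? T
  -- A default value, for which the claim is vacuous; it lets a single vector `popular` serve both
  -- families.
  ... | no  i∉T = lookup⁺ (origin {p = p} p≥2) i , λ i∈T → contradiction i∈T i∉T
  ... | yes i∈T with relevant⇒concentrated r≤n p≥2 {A} {B} maximal i (Equivalence.to (relevant i) i∈T)
  ... | l , large = l , λ _ → large

  popular : S p
  popular = lookup⁻ (proj₁ ∘ popularValue)

  concentrated : ∀ i → i ∈ T → Concentrated A i (lookup⁺ popular i) × Concentrated B i (lookup⁺ popular i)
  concentrated i i∈T = subst (λ l → Concentrated A i l × Concentrated B i l)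
    (sym (lookup⁺-lookup⁻ p (proj₁ ∘ popularValue) i)) (proj₂ (popularValue i) i∈T)
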